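{- Let $n$ and $r$ be positive integers and let $\zeta_n$ be a primitive $n$-th root of unity. For any nonnegative integers $k,l,h_1,\ldots,h_r$, we have $$G^t_n(k,l,h_1,\ldots,h_r;\zeta_n)\in\mathbb{Q}[t].$$
   Context: $\mathbb{N}$ is the set of positive integers and $t$ is a formal parameter. For a multi-index $\mathbf{k}=(k_1,\ldots,k_l)\in\mathbb{N}^l$ define the weight $\mathrm{wt}(\mathbf{k})=k_1+\cdots+k_l$, the depth $\mathrm{dep}(\mathbf{k})=l$, and for $i\in\mathbb{N}$ the $i$-height $\#\{j\mid k_j\geq i+1\}$. Let $q$ be a complex number with $q^m\ne1$ for every positive integer $m<n$ (e.g. $q=\zeta_n$). For $\mathbf{k}\in\mathbb{N}^l$ with $l\ge 1$, $$\overline{z}_n(\mathbf{k};q)=\sum_{n>m_1>\cdots>m_l>0}\frac{q^{(k_1-1)m_1+\cdots+(k_l-1)m_l}}{(1-q^{m_1})^{k_1}\cdots(1-q^{m_l})^{k_l}},$$ and its interpolated version is $$\overline{z}_n^t(\mathbf{k};q)=\sum_{\mathbf{p}}\overline{z}_n(\mathbf{p};q)\,t^{l-\mathrm{dep}(\mathbf{p})},$$ where the sum runs over all $3^{l-1}$ ways of forming $\mathbf{p}=(k_1\Box\cdots\Box k_l)$ by filling each $\Box$ with "," (comma), "$+$" or "$-1+$". For nonnegative integers $k,l,h_1,\ldots,h_r$ let $I(k,l,h_1,\ldots,h_r)$ be the set of multi-indices of weight $k$, depth $l$ and $i$-height $h_i$ for $i=1,\ldots,r$, and $$G_n^t(k,l,h_1,\ldots,h_r;q)=\sum_{\mathbf{k}\in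 I(k,l,h_1,\ldots,h_r)}\overline{z}_n^t(\mathbf{k};q),$$ which is $0$ when the index set is empty, except that $G_n^t(0,0,\ldots,0;q)=1$. -}

module Defs where

open import Algebra.Apartness.Bundles using (HeytingCommutativeRing; HeytingField)
open import Algebra.Bundles using (CommutativeRing)
import Algebra.Properties.CommutativeMonoid.Sum
import Algebra.Properties.Monoid.Mult
import Algebra.Properties.Semiring.Exp
open import Data.Fin.Base using (Fin; toℕ)
open import Data.Fin.Properties using (toℕ<n)
import Data.Fin.Properties as Fin
open import Data.Integer.Base using (ℤ; +_; -[1+_])
open import Data.List.Base as List using (List; []; _∷_; cartesianProductWith)
open import Data.List.Membership.Propositional using (_∈_)
open import Data.List.Membership.Propositional.Properties
open import Data.List.Relation.Unary.Any using (here)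
open import Data.List.Relation.Unary.Unique.Propositional using (Unique)
import Data.List.Relation.Unary.Unique.Propositional.Properties as Unique
import Data.List.Relation.Unary.All as ListAll
import Data.List.Relation.Unary.AllPairs as AllPairs
open import Data.Nat.Base as ℕ using (ℕ; zero; suc; pred; _∸_; _≤_; _<_; NonZero)
open import Data.Nat.Properties as ℕ using ()
open import Data.Product.Base using (∃; _×_; _,_; proj₁; proj₂)
open import Data.Rational.Base using (ℚ; mkℚ)
open import Data.Vec.Base as Vec using (Vec; []; _∷_; lookup)
import Data.Vec.Properties as Vec
open import Data.Vec.Relation.Unary.All as All using (All; []; _∷_)
open import Function.Bundles using (_⇔_; mk⇔)
open import Level using (_⊔_)
open import Relation.Binary.PropositionalEquality as ≡ using (_≡_)
open import Relation.Nullary.Decidable using (_×-dec_)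
open import Relation.Unary using (Decidable)

vectors : ∀ {a} {A : Set a} → List A → ∀ l → List (Vec A l)
vectors xs zero    = [] ∷ []
vectors xs (suc l) = cartesianProductWith _∷_ xs (vectors xs l)

weight : ∀ {l} → Vec ℕ l → ℕ
weight = Vec.sum

height : ∀ {l} → ℕ → Vec ℕ l → ℕ
height i = Vec.count (suc i ℕ.≤?_)

-- lookup h i is the prescribed (toℕ i + 1)-height: Fin counts from 0.

InI : ∀ k {l r} → Vec ℕ r → Vec ℕ l → Set
InI k h 𝐤 = All (1 ≤_) 𝐤 × weight 𝐤 ≡ k ×
            (∀ i → height (suc (toℕ i)) 𝐤 ≡ lookup h i)

InI? : ∀ k {l r} (h : Vec ℕ r) → Decidable (InI k {l} h)
InI? k h 𝐤 = All.all? (1 ℕ.≤?_) 𝐤 ×-dec (weight 𝐤 ℕ.≟ k) ×-dec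
             Fin.all? (λ i → height (suc (toℕ i)) 𝐤 ℕ.≟ lookup h i)

-- The entries of a multi-index of weight k lie in {1,…,k}, so nothing is
-- lost by searching only there; see ∈I⇔ and I-unique.

I : ∀ {r} (k l : ℕ) → Vec ℕ r → List (Vec ℕ l)
I k l h = List.filter (InI? k h) (vectors (List.map suc (List.upTo k)) l)

∈-vectors : ∀ {a} {A : Set a} {xs : List A} {l} {v : Vec A l} →
            All (_∈ xs) v → v ∈ vectors xs l
∈-vectors []           = here ≡.refl
∈-vectors (x∈xs ∷ v∈xs) = ∈-cartesianProductWith⁺ _∷_ x∈xs (∈-vectors v∈xs)

vectors-unique : ∀ {a} {A : Set a} {xs : List A} → Unique xs →
                 ∀ l → Unique (vectors xs l)
vectors-unique xs! zero    = ListAll.[] AllPairs.∷ AllPairs.[]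
vectors-unique xs! (suc l) =
  Unique.cartesianProductWith⁺ _∷_ Vec.∷-injective xs! (vectors-unique xs! l)

entries-bounded : ∀ {l K} (𝐤 : Vec ℕ l) → All (1 ≤_) 𝐤 → weight 𝐤 ≤ K →
                  All (_∈ List.map suc (List.upTo K)) 𝐤
entries-bounded []          _        _   = []
entries-bounded (suc a ∷ 𝐤) (_ ∷ ps) w≤K =
  ∈-map⁺ suc (∈-upTo⁺ (ℕ.≤-trans (ℕ.m≤m+n (suc a) (weight 𝐤)) w≤K)) ∷
  entries-bounded 𝐤 ps (ℕ.≤-trans (ℕ.m≤n+m (weight 𝐤) (suc a)) w≤K)

∈I⇔ : ∀ k l {r} (h : Vec ℕ r) {𝐤 : Vec ℕ l} → 𝐤 ∈ I k l h ⇔ InI k h 𝐤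
∈I⇔ k l h {𝐤} = mk⇔
  (λ 𝐤∈ → proj₂ (∈-filter⁻ (InI? k h) {xs = vectors _ l} 𝐤∈))
  (λ { p@(pos , w≡k , _) → ∈-filter⁺ (InI? k h)
         (∈-vectors (entries-bounded 𝐤 pos (ℕ.≤-reflexive w≡k))) p })

I-unique : ∀ k l {r} (h : Vec ℕ r) → Unique (I k l h)
I-unique k l h = Unique.filter⁺ (InI? k h)
  (vectors-unique (Unique.map⁺ ℕ.suc-injective (Unique.upTo⁺ k)) l)

------------------------------------------------------------------------
-- The fillings of k₁ □ ⋯ □ kₗ

data Box : Set where
  comma plus -1+ : Box

boxes : List Box
boxes = comma ∷ plus ∷ -1+ ∷ []

-- k is the entry being accumulated.  Entries are positive, so the
-- truncated subtraction is an ordinary one.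

fill : ∀ {l} → ℕ → Vec Box l → Vec ℕ l → List ℕ
fill k []           []        = k ∷ []
fill k (comma ∷ □s) (k′ ∷ ks) = k ∷ fill k′ □s ks
fill k (plus  ∷ □s) (k′ ∷ ks) = fill (k ℕ.+ k′) □s ks
fill k (-1+   ∷ □s) (k′ ∷ ks) = fill (k ∸ 1 ℕ.+ k′) □s ks

------------------------------------------------------------------------
-- Polynomials in t as coefficient lists, constant term first, compared
-- coefficientwise so that trailing zeros are immaterial.

coeff : ∀ {a} {A : Set a} → A → List A → ℕ → A
coeff 0a []      _       = 0a
coeff 0a (a ∷ _) zero    = a
coeff 0a (_ ∷ p) (suc i) = coeff 0a p i

------------------------------------------------------------------------
-- The ambient field K generalises ℂ.  In a Heyting field the apartness _#_
-- is the constructive reading of ≠: x # y says that x - y is invertible.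

module OverField {c ℓ₁ ℓ₂} (K : HeytingField c ℓ₁ ℓ₂) where

  open HeytingField K
  open HeytingCommutativeRing heytingCommutativeRing using (commutativeRing)
  open CommutativeRing commutativeRing
    using (semiring; +-monoid; +-commutativeMonoid)
  open Algebra.Properties.Semiring.Exp semiring using (_^_)
  open Algebra.Properties.Monoid.Mult +-monoid using () renaming (_×_ to _·_)
  open Algebra.Properties.CommutativeMonoid.Sum +-commutativeMonoid
    using (sum-syntax)

  1/[_] : ∀ {x y} → x # y → Carrier
  1/[ x#y ] = proj₁ (#⇒invertible x#y)   -- inverse of x - y

  CharZero : Set ℓ₂
  CharZero = ∀ n → .{{NonZero n}} → n · 1# # 0#

  fromℤ : ℤ → Carrier
  fromℤ (+ n)    = n · 1#
  fromℤ -[1+ n ] = - (suc n · 1#)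

  fromℚ : CharZero → ℚ → Carrier
  fromℚ char0 (mkℚ a d-1 _) = fromℤ a * 1/[ char0 (suc d-1) ]

  record IsPrimitiveRoot (n : ℕ) (ζ : Carrier) : Set (ℓ₁ ⊔ ℓ₂) where
    field
      ζⁿ≈1 : ζ ^ n ≈ 1#
      1#ζᵐ : ∀ {m} → 0 < m → m < n → 1# # ζ ^ m

  Poly : Set c
  Poly = List Carrier

  infix 4 _≈ₚ_

  _≈ₚ_ : Poly → Poly → Set ℓ₁
  p ≈ₚ p′ = ∀ i → coeff 0# p i ≈ coeff 0# p′ i

  infixl 6 _+ₚ_

  _+ₚ_ : Poly → Poly → Poly
  []      +ₚ p′       = p′
  (a ∷ p) +ₚ []       = a ∷ p
  (a ∷ p) +ₚ (b ∷ p′) = (a + b) ∷ (p +ₚ p′)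

  sumₚ : List Poly → Poly
  sumₚ = List.foldr _+ₚ_ []

  infix 8 _t^_

  _t^_ : Carrier → ℕ → Poly
  a t^ j = List.replicate j 0# List.++ (a ∷ [])

  _∈ℚ[t]_ : Poly → CharZero → Set ℓ₁
  p ∈ℚ[t] char0 = ∃ λ (P : List ℚ) → p ≈ₚ List.map (fromℚ char0) P

  module _ (n : ℕ) (q : Carrier)
           (1#qᵐ : ∀ {m} → 0 < m → m < n → 1# # q ^ m) where

    -- The sum over N > m₁ > ⋯ > mₗ > 0, where m₁ = toℕ i + 1 runs through
    -- {1,…,N - 1}.  The empty multi-index gets the value 1.

    z̄-below : ∀ N → N ≤ n → List ℕ → Carrier
    z̄-below N N≤n []       = 1#
    z̄-below N N≤n (k ∷ ks) = ∑[ i < pred N ] term i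
      where
      m<N : ∀ {N} (i : Fin (pred N)) → suc (toℕ i) < N
      m<N {suc N} i = ℕ.s<s (toℕ<n i)

      term : Fin (pred N) → Carrier
      term i = q ^ ((k ∸ 1) ℕ.* m) * 1/[ 1#qᵐ ℕ.z<s m<n ] ^ k
               * z̄-below m (ℕ.<⇒≤ m<n) ks
        where
        m : ℕ
        m = suc (toℕ i)

        m<n : m < n
        m<n = ℕ.<-≤-trans (m<N i) N≤n

    z̄ : List ℕ → Carrier
    z̄ = z̄-below n ℕ.≤-refl

    -- The value 1 at the empty multi-index makes G 0 0 h equal to 1 when
    -- h is zero; for depth 0 all other index sets are empty.

    z̄ᵗ : ∀ {l} → Vec ℕ l → Poly
    z̄ᵗ []               = 1# t^ 0
    z̄ᵗ {suc l} (k ∷ ks) = sumₚ (List.map summand (vectors boxes l))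
      where
      summand : Vec Box l → Poly
      summand □s = z̄ p t^ (suc l ∸ List.length p)
        where
        p : List ℕ
        p = fill k □s ks

    G : ∀ {r} (k l : ℕ) → Vec ℕ r → Poly
    G k l h = sumₚ (List.map z̄ᵗ (I k l h))

{-# OPTIONS --safe #-}

-- With x = q^m and f_k(m) = x^(k-1) / (1 - x)^k one has
-- f_{a+b} + f_{a-1+b} = f_a f_b.  So the two ways of merging neighbours turn
-- z̄ᵗ(k₁,…,kₗ) into the sum of t^(number of equalities) ∏ f_{kᵢ}(mᵢ) over
-- n > m₁ ≥ ⋯ ≥ mₗ > 0.  The index sets of G are stable under permutation, so
-- the coefficient of each power of t is a sum over m₁ > ⋯ > mₛ of a function
-- symmetric in the m's, hence 1/s! times the sum over pairwise distinct m's.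
-- At q = ζₙ both the summand and the indicator of distinctness (by orthogonality
-- of characters) are polynomials over ℚ in ζ^{m₁},…,ζ^{mₛ}, and the power sums
-- of the ζ^m with 0 < m < n are rational.

module Submission where

open import Defs
open import Algebra.Apartness.Bundles using (HeytingCommutativeRing; HeytingField)
open import Algebra.Bundles using (CommutativeRing)
import Algebra.Properties.CommutativeSemiring.Exp
import Algebra.Properties.Ring
import Algebra.Properties.Semiring.Exp
import Algebra.Properties.Semiring.Mult
import Algebra.Properties.Semiring.Sum
import Algebra.Solver.Ring.NaturalCoefficients.Default
open import Data.Bool.Base using (true; false; if_then_else_)
open import Data.Empty using (⊥-elim)
open import Data.Fin.Base using (Fin; zero; suc; toℕ)
open import Data.Fin.Properties using (toℕ<n; toℕ-inject₁; toℕ-fromℕ)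
open import Data.Integer.Base as ℤ using (+_; -[1+_]; _⊖_)
import Data.Integer.Properties as ℤ
open import Data.List.Base as List
  using (List; []; _∷_; _++_; length; replicate; cartesianProductWith)
open import Data.List.Relation.Binary.Permutation.Propositional as ↭ using (_↭_)
import Data.List.Relation.Binary.Permutation.Propositional.Properties as ↭ₚ
open import Data.List.Relation.Unary.All using (All; []; _∷_)
open import Data.Nat.Base as ℕ using (ℕ; zero; suc; _≤_; _<_; z≤n; s≤s; _!; NonZero)
open import Data.Nat.DivMod using (_%_; _/_; m≡m%n+[m/n]*n; m%n<n)
import Data.Nat.Properties as ℕ
open import Data.Product.Base using (∃; _×_; _,_; proj₁; proj₂)
open import Data.Rational.Base using (mkℚ; fromℚᵘ; toℚᵘ)
import Data.Rational.Properties as ℚ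
open import Data.Rational.Unnormalised.Base using (mkℚᵘ; _≃_; *≡*)
open import Data.Vec.Base as Vec using (Vec; []; _∷_; toList)
import Data.Vec.Relation.Unary.All as VecAll
open import Data.Vec.Relation.Unary.All using ([]; _∷_)
open import Function.Base using (_∘_)
open import Level using (_⊔_)
open import Relation.Binary.Definitions using (tri<; tri≈; tri>)
open import Relation.Binary.PropositionalEquality as ≡ using (_≡_; _≢_)
import Relation.Binary.Reasoning.Setoid
open import Relation.Nullary.Decidable using (Dec; yes; no; does; _×-dec_)
open import Relation.Unary using (Decidable)

-- A single value need not be rational: for n = 3 only m₁ = 2, m₂ = 1 occur in depth two, and the
-- entries (1,2) give (ζ - 1)/9. Passing to another primitive root permutes the indices without
-- keeping their order, so the order has to disappear before rationality can show. Equal indices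
-- must be separated out before that, and this shapes the encoding. A weakly decreasing word is the
-- strictly decreasing word of its distinct letters with each letter blown up to a block. For a
-- symmetric function the sum over all block sizes is symmetric in the distinct letters, although
-- the term of one fixed choice of sizes need not be. As block sizes change the length, functions of
-- words live on lists of every length, and a support condition selects the right total. Rationality
-- is treated as an arbitrary predicate closed under the ring operations and under division by
-- positive integers, which disposes of s!. Summing out one index at a time then only asks for power
-- sums.

module SymmetricSums {c ℓ} (R : CommutativeRing c ℓ) where

  open CommutativeRing R hiding (zero)
  open Algebra.Properties.Ring (CommutativeRing.ring R) using (-1*x≈-x)
  open Algebra.Properties.Semiring.Sum semiring
  open Algebra.Properties.Semiring.Exp semiring
  open Algebra.Properties.Semiring.Mult semiring
    using (×-congʳ; ×-assocˡ) renaming (_×_ to _·_)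
  open Algebra.Solver.Ring.NaturalCoefficients.Default commutativeSemiring
    using (solve; _:=_; _:+_; _:*_)
  open Relation.Binary.Reasoning.Setoid setoid

  -- Finite sums in a commutative ring

  sum-last : ∀ N (f : ℕ → Carrier) →
             sum {suc N} (f ∘ toℕ) ≈ sum {N} (f ∘ toℕ) + f N
  sum-last N f = trans (sum-init-last {N} (f ∘ toℕ))
    (+-cong (sum-cong-≋ {N} λ i → reflexive (≡.cong f (toℕ-inject₁ i)))
            (reflexive (≡.cong f (toℕ-fromℕ N))))

  sum-zero : ∀ {n} {f : Fin n → Carrier} → (∀ i → f i ≈ 0#) → sum f ≈ 0#
  sum-zero {n} f≈0 = trans (sum-cong-≋ f≈0) (sum-replicate-zero n)

  ·-distribˡ-+ : ∀ n x y → n · (x + y) ≈ n · x + n · y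
  ·-distribˡ-+ zero    x y = sym (+-identityˡ 0#)
  ·-distribˡ-+ (suc n) x y = trans (+-congˡ (·-distribˡ-+ n x y))
    (solve 4 (λ a b c d → a :+ b :+ (c :+ d) := a :+ c :+ (b :+ d))
       refl x y (n · x) (n · y))

  a*[b*c]≈b*[a*c] : ∀ a b c → a * (b * c) ≈ b * (a * c)
  a*[b*c]≈b*[a*c] = solve 3 (λ a b c → a :* (b :* c) := b :* (a :* c)) refl

  -- Linear functionals

  Functional : Set c
  Functional = (List ℕ → Carrier) → Carrier

  record Linear (𝓛 : (List ℕ → Carrier) → Carrier) : Set (c ⊔ ℓ) where
    field
      cong   : ∀ {Ψ Ψ′} → (∀ M → Ψ M ≈ Ψ′ M) → 𝓛 Ψ ≈ 𝓛 Ψ′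
      +-homo : ∀ Ψ Ψ′ → 𝓛 (λ M → Ψ M + Ψ′ M) ≈ 𝓛 Ψ + 𝓛 Ψ′
      *-homo : ∀ a Ψ → 𝓛 (λ M → a * Ψ M) ≈ a * 𝓛 Ψ

    0-homo : ∀ {Ψ} → (∀ M → Ψ M ≈ 0#) → 𝓛 Ψ ≈ 0#
    0-homo {Ψ} Ψ≈0 = begin
      𝓛 Ψ                 ≈⟨ cong (λ M → trans (Ψ≈0 M) (sym (zeroˡ _))) ⟩
      𝓛 (λ M → 0# * Ψ M)  ≈⟨ *-homo 0# Ψ ⟩
      0# * 𝓛 Ψ            ≈⟨ zeroˡ _ ⟩
      0#                  ∎

    sum-homo : ∀ {n} (Ψ : Fin n → List ℕ → Carrier) →
               𝓛 (λ M → sum λ i → Ψ i M) ≈ sum λ i → 𝓛 (Ψ i)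
    sum-homo {zero}  Ψ = 0-homo λ _ → refl
    sum-homo {suc n} Ψ = trans (+-homo (Ψ zero) _) (+-congˡ (sum-homo (Ψ ∘ suc)))

    combination : ∀ {n} (a : Fin n → Carrier) (Ψ : Fin n → List ℕ → Carrier) →
                  𝓛 (λ M → sum λ i → a i * Ψ i M) ≈ sum λ i → a i * 𝓛 (Ψ i)
    combination a Ψ = trans (sum-homo λ i M → a i * Ψ i M)
                            (sum-cong-≋ λ i → *-homo (a i) (Ψ i))

  open Linear

  evaluation-linear : ∀ M → Linear (λ Ψ → Ψ M)
  evaluation-linear M = record
    { cong   = λ Ψ≈Ψ′ → Ψ≈Ψ′ M
    ; +-homo = λ _ _ → refl
    ; *-homo = λ _ _ → refl
    }

  +-linear : ∀ {𝓛 𝓜} → Linear 𝓛 → Linear 𝓜 → Linear (λ Ψ → 𝓛 Ψ + 𝓜 Ψ)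
  +-linear 𝓛-lin 𝓜-lin = record
    { cong   = λ Ψ≈Ψ′ → +-cong (cong 𝓛-lin Ψ≈Ψ′) (cong 𝓜-lin Ψ≈Ψ′)
    ; +-homo = λ Ψ Ψ′ → trans (+-cong (+-homo 𝓛-lin Ψ Ψ′) (+-homo 𝓜-lin Ψ Ψ′))
        (solve 4 (λ a b c d → a :+ b :+ (c :+ d) := a :+ c :+ (b :+ d)) refl _ _ _ _)
    ; *-homo = λ a Ψ → trans (+-cong (*-homo 𝓛-lin a Ψ) (*-homo 𝓜-lin a Ψ))
                             (sym (distribˡ a _ _))
    }

  *-linear : ∀ {𝓛} b → Linear 𝓛 → Linear (λ Ψ → b * 𝓛 Ψ)
  *-linear b 𝓛-lin = record
    { cong   = λ Ψ≈Ψ′ → *-congˡ (cong 𝓛-lin Ψ≈Ψ′)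
    ; +-homo = λ Ψ Ψ′ → trans (*-congˡ (+-homo 𝓛-lin Ψ Ψ′)) (distribˡ b _ _)
    ; *-homo = λ a Ψ → trans (*-congˡ (*-homo 𝓛-lin a Ψ)) (a*[b*c]≈b*[a*c] b a _)
    }

  sum-linear : ∀ {n} {𝓛 : Fin n → Functional} →
               (∀ i → Linear (𝓛 i)) → Linear (λ Ψ → sum λ i → 𝓛 i Ψ)
  sum-linear {n} {𝓛} 𝓛-lin = record
    { cong   = λ Ψ≈Ψ′ → sum-cong-≋ {n} λ i → cong (𝓛-lin i) Ψ≈Ψ′
    ; +-homo = λ Ψ Ψ′ → trans (sum-cong-≋ {n} λ i → +-homo (𝓛-lin i) Ψ Ψ′)
                              (∑-distrib-+ (λ i → 𝓛 i Ψ) (λ i → 𝓛 i Ψ′))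
    ; *-homo = λ a Ψ → trans (sum-cong-≋ {n} λ i → *-homo (𝓛-lin i) a Ψ)
                             (sym (*-distribˡ-sum a λ i → 𝓛 i Ψ))
    }

  ∘-linear : ∀ {𝓛} {𝓜 : List ℕ → Functional} → Linear 𝓛 → (∀ M → Linear (𝓜 M)) →
             Linear (λ Ψ → 𝓛 (λ M → 𝓜 M Ψ))
  ∘-linear 𝓛-lin 𝓜-lin = record
    { cong   = λ Ψ≈Ψ′ → cong 𝓛-lin λ M → cong (𝓜-lin M) Ψ≈Ψ′
    ; +-homo = λ Ψ Ψ′ → trans (cong 𝓛-lin λ M → +-homo (𝓜-lin M) Ψ Ψ′) (+-homo 𝓛-lin _ _)
    ; *-homo = λ a Ψ → trans (cong 𝓛-lin λ M → *-homo (𝓜-lin M) a Ψ) (*-homo 𝓛-lin a _)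
    }

  translation-linear : ∀ {𝓛} (g : List ℕ → List ℕ) → Linear 𝓛 → Linear (λ Ψ → 𝓛 (Ψ ∘ g))
  translation-linear g 𝓛-lin = ∘-linear 𝓛-lin λ M → evaluation-linear (g M)

  -- Sums over decreasing words

  strict : ℕ → ℕ → Functional
  strict N zero    Ψ = Ψ []
  strict N (suc s) Ψ = sum {N} λ i → strict (toℕ i) s (Ψ ∘ (toℕ i ∷_))

  strict-linear : ∀ N s → Linear (strict N s)
  strict-linear N zero    = evaluation-linear []
  strict-linear N (suc s) = sum-linear {N} λ i →
    translation-linear (toℕ i ∷_) (strict-linear (toℕ i) s)

  -- The words m ∷ M over {0,…,m} that are weakly decreasing, M having length l,
  -- weighted by w at the number of strict descents.

  weak : ℕ → (ℕ → Carrier) → ℕ → Functional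
  weak m w zero    Ψ = w 0 * Ψ []
  weak m w (suc l) Ψ = weak m w l (Ψ ∘ (m ∷_)) +
                       sum {m} λ j → weak (toℕ j) (w ∘ suc) l (Ψ ∘ (toℕ j ∷_))

  weak-linear : ∀ m w l → Linear (weak m w l)
  weak-linear m w zero    = *-linear (w 0) (evaluation-linear [])
  weak-linear m w (suc l) =
    +-linear (translation-linear (m ∷_) (weak-linear m w l))
             (sum-linear {m} λ j →
                translation-linear (toℕ j ∷_) (weak-linear (toℕ j) (w ∘ suc) l))

  repeat : ∀ {L} → Fin L → ℕ → List ℕ → List ℕ
  repeat c m M = replicate (toℕ c) m ++ M

  -- Ψ summed over the words in which every letter of the given word has become
  -- a block of between 1 and L copies of itself.

  inflate : ℕ → List ℕ → Functional
  inflate L []       Ψ = Ψ []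
  inflate L (m ∷ ms) Ψ = sum {L} λ c → inflate L ms (Ψ ∘ (m ∷_) ∘ repeat c m)

  inflate-linear : ∀ L ms → Linear (inflate L ms)
  inflate-linear L []       = evaluation-linear []
  inflate-linear L (m ∷ ms) = sum-linear {L} λ c →
    translation-linear ((m ∷_) ∘ repeat c m) (inflate-linear L ms)

  inflated : ℕ → (List ℕ → Carrier) → List ℕ → Carrier
  inflated L Ψ ms = inflate L ms Ψ

  strict-inflated-linear : ∀ N s L → Linear (strict N s ∘ inflated L)
  strict-inflated-linear N s L = ∘-linear (strict-linear N s) (inflate-linear L)

  -- Block sizes are summed independently, so words of many lengths occur. A function vanishing off
  -- length `l` retains just those choices of sizes that add up to `l`.
  SupportedOn : ℕ → (List ℕ → Carrier) → Set ℓ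
  SupportedOn l Ψ = ∀ M → length M ≢ l → Ψ M ≈ 0#

  supportedOn-∷ : ∀ {l Ψ} m → SupportedOn (suc l) Ψ → SupportedOn l (Ψ ∘ (m ∷_))
  supportedOn-∷ m supp M |M|≢l = supp (m ∷ M) (|M|≢l ∘ ℕ.suc-injective)

  strict-inflated-suc : ∀ N s L Ψ →
    strict N (suc s) (inflated L Ψ) ≈
    sum {N} λ j → sum {L} λ c → strict (toℕ j) s (inflated L (Ψ ∘ (toℕ j ∷_) ∘ repeat c (toℕ j)))
  strict-inflated-suc N s L Ψ = sum-cong-≋ {N} λ j →
    sum-homo (strict-linear (toℕ j) s) {L} λ c → inflated L (Ψ ∘ (toℕ j ∷_) ∘ repeat c (toℕ j))

  -- A weakly decreasing word is determined by its distinct letters and their multiplicities. The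
  -- letter `m` has already been emitted, so `c` counts its further copies and may be 0. `L`, `C`
  -- and `S` only have to be large enough, since the support kills any excess. They are separate
  -- because repeating `m` lowers `C`, whereas a descent lowers `S` and restarts `C` at `L`.
  weak≈strict : ∀ l {L C S} → l < L → l < C → l < S → ∀ m w {Ψ} → SupportedOn l Ψ →
    weak m w l Ψ ≈ sum {S} λ s → w (toℕ s) *
      sum {C} λ c → strict m (toℕ s) (inflated L (Ψ ∘ repeat c m))
  weak≈strict zero {L} {suc C} {suc S} l<L l<C l<S m w {Ψ} supp = sym (begin
    w 0 * (Ψ [] + sum {C} λ c → Ψ (m ∷ repeat c m [])) + sum {S} _
      ≈⟨ +-cong (*-congˡ (+-congˡ (sum-zero {C} λ c → supp (m ∷ repeat c m []) λ ())))
                (sum-zero {S} λ s → trans (*-congˡ (sum-zero {suc C} (descents s))) (zeroʳ _)) ⟩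
    w 0 * (Ψ [] + 0#) + 0#
      ≈⟨ trans (+-identityʳ _) (*-congˡ (+-identityʳ _)) ⟩
    w 0 * Ψ []  ∎)
    where
    nonempty : ∀ xs {y} M → length (xs ++ y ∷ M) ≢ 0
    nonempty []       M ()
    nonempty (_ ∷ xs) M ()

    descents : ∀ (s : Fin S) (c : Fin (suc C)) → strict m (suc (toℕ s)) (inflated L (Ψ ∘ repeat c m)) ≈ 0#
    descents s c = trans (strict-inflated-suc m (toℕ s) L (Ψ ∘ repeat c m))
      (sum-zero {m} λ j → sum-zero {L} λ c′ → 0-homo (strict-inflated-linear (toℕ j) (toℕ s) L) λ M →
        supp _ (nonempty (replicate (toℕ c) m) (repeat c′ (toℕ j) M)))
  weak≈strict (suc l) {L} {suc C} {suc S} l<L (s≤s l<C) (s≤s l<S) m w {Ψ} supp = sym (begin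
    (sum {suc S} λ s → w (toℕ s) * (g (toℕ s) zero + sum {C} λ c → g (toℕ s) (suc c)))
      -- The column `c = 0` collects the words that descend at once, apart from the empty word,
      -- where `Ψ` vanishes; the columns `c ≥ 1` collect those that repeat `m` first.
      ≈⟨ trans (sum-cong-≋ {suc S} λ s → distribˡ (w (toℕ s)) (g (toℕ s) zero) (tail (toℕ s)))
               (∑-distrib-+ {suc S} (λ s → w (toℕ s) * g (toℕ s) zero)
                                    (λ s → w (toℕ s) * tail (toℕ s))) ⟩
    (w 0 * Ψ [] + sum {S} λ s → w (suc (toℕ s)) * g (suc (toℕ s)) zero) +
    (sum {suc S} λ s → w (toℕ s) * sum {C} λ c → g (toℕ s) (suc c))
      ≈⟨ +-cong (trans (+-congʳ (trans (*-congˡ (supp [] λ ())) (zeroʳ _))) (+-identityˡ _))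
                (sym (weak≈strict l (ℕ.<⇒≤ l<L) l<C (ℕ.m≤n⇒m≤1+n l<S) m w (supportedOn-∷ m supp))) ⟩
    (sum {S} λ s → w (suc (toℕ s)) * g (suc (toℕ s)) zero) + weak m w l (Ψ ∘ (m ∷_))
      ≈⟨ +-comm _ _ ⟩
    weak m w l (Ψ ∘ (m ∷_)) + (sum {S} λ s → w (suc (toℕ s)) * strict m (suc (toℕ s)) (inflated L Ψ))
      ≈⟨ +-congˡ (begin
        (sum {S} λ s → w (suc (toℕ s)) * strict m (suc (toℕ s)) (inflated L Ψ))
          ≈⟨ sum-cong-≋ {S} (λ s → trans (*-congˡ (strict-inflated-suc m (toℕ s) L Ψ)) (*-distribˡ-sum {m} _ _)) ⟩
        (sum {S} λ s → sum {m} λ j → w (suc (toℕ s)) * h (toℕ s) (toℕ j))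
          ≈⟨ ∑-comm {S} {m} (λ s j → w (suc (toℕ s)) * h (toℕ s) (toℕ j)) ⟩
        (sum {m} λ j → sum {S} λ s → w (suc (toℕ s)) * h (toℕ s) (toℕ j))
          ≈⟨ sum-cong-≋ {m} (λ j → sym
               (weak≈strict l (ℕ.<⇒≤ l<L) (ℕ.<⇒≤ l<L) l<S (toℕ j) (w ∘ suc) (supportedOn-∷ (toℕ j) supp))) ⟩
        (sum {m} λ j → weak (toℕ j) (w ∘ suc) l (Ψ ∘ (toℕ j ∷_)))  ∎) ⟩
    weak m w (suc l) Ψ  ∎)
    where
    g : ℕ → Fin (suc C) → Carrier
    g s c = strict m s (inflated L (Ψ ∘ repeat c m))

    tail : ℕ → Carrier
    tail s = sum {C} λ c → g s (suc c)

    h : ℕ → ℕ → Carrier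
    h s j = sum {L} λ c → strict j s (inflated L (Ψ ∘ (j ∷_) ∘ repeat c j))

  -- A word with `s` descents has `s + 1` distinct letters, hence the shift between `w` and
  -- `strict`.
  weakly-decreasing≈strict : ∀ N w l {Ψ} → SupportedOn (suc l) Ψ →
    (sum {N} λ i → weak (toℕ i) w l (Ψ ∘ (toℕ i ∷_))) ≈
    sum {suc l} λ s → w (toℕ s) * strict N (suc (toℕ s)) (inflated (suc l) Ψ)
  weakly-decreasing≈strict N w l {Ψ} supp = begin
    (sum {N} λ i → weak (toℕ i) w l (Ψ ∘ (toℕ i ∷_)))
      ≈⟨ sum-cong-≋ {N} (λ i → weak≈strict l ℕ.≤-refl ℕ.≤-refl ℕ.≤-refl (toℕ i) w
           (supportedOn-∷ (toℕ i) supp)) ⟩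
    (sum {N} λ i → sum {suc l} λ s → w (toℕ s) * h (toℕ s) (toℕ i))
      ≈⟨ ∑-comm {N} {suc l} (λ i s → w (toℕ s) * h (toℕ s) (toℕ i)) ⟩
    (sum {suc l} λ s → sum {N} λ i → w (toℕ s) * h (toℕ s) (toℕ i))
      ≈⟨ sum-cong-≋ {suc l} (λ s → trans (sym (*-distribˡ-sum {N} (w (toℕ s)) λ i → h (toℕ s) (toℕ i)))
           (*-congˡ (sym (strict-inflated-suc N (toℕ s) (suc l) Ψ)))) ⟩
    (sum {suc l} λ s → w (toℕ s) * strict N (suc (toℕ s)) (inflated (suc l) Ψ))  ∎
    where
    h : ℕ → ℕ → Carrier
    h s j = sum {suc l} λ c → strict j s (inflated (suc l) (Ψ ∘ (j ∷_) ∘ repeat c j))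

  -- Symmetrisation

  Symmetric : (List ℕ → Carrier) → Set ℓ
  Symmetric Ψ = ∀ {M M′} → M ↭ M′ → Ψ M ≈ Ψ M′

  -- Swapping two letters swaps adjacent blocks. Both block sizes run over the same range, so
  -- exchanging the two sums and moving one block past the other inside `Ψ` matches the terms.
  inflated-symmetric : ∀ L {Ψ} → Symmetric Ψ → Symmetric (inflated L Ψ)
  inflated-symmetric L Ψ-sym ↭.refl = refl
  inflated-symmetric L Ψ-sym (↭.prep m p) = sum-cong-≋ {L} λ c →
    inflated-symmetric L (Ψ-sym ∘ ↭.prep m ∘ ↭ₚ.++⁺ˡ (replicate (toℕ c) m)) p
  inflated-symmetric L {Ψ} Ψ-sym (↭.swap {xs} {ys} m m′ p) = begin
    (sum {L} λ c → sum {L} λ c′ → inflated L (Ψ ∘ (m ∷_) ∘ repeat c m ∘ (m′ ∷_) ∘ repeat c′ m′) xs)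
      ≈⟨ ∑-comm {L} {L} _ ⟩
    (sum {L} λ c′ → sum {L} λ c → inflated L (Ψ ∘ (m ∷_) ∘ repeat c m ∘ (m′ ∷_) ∘ repeat c′ m′) xs)
      ≈⟨ sum-cong-≋ {L} (λ c′ → sum-cong-≋ {L} λ c → trans
           (inflated-symmetric L
             (Ψ-sym ∘ ↭.prep m ∘ ↭ₚ.++⁺ˡ (replicate (toℕ c) m) ∘ ↭.prep m′ ∘ ↭ₚ.++⁺ˡ (replicate (toℕ c′) m′)) p)
           (cong (inflate-linear L ys) λ M →
             Ψ-sym (↭ₚ.shifts (m ∷ replicate (toℕ c) m) (m′ ∷ replicate (toℕ c′) m′)))) ⟩
    (sum {L} λ c′ → sum {L} λ c → inflated L (Ψ ∘ (m′ ∷_) ∘ repeat c′ m′ ∘ (m ∷_) ∘ repeat c m) ys)  ∎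
  inflated-symmetric L Ψ-sym (↭.trans p q) =
    trans (inflated-symmetric L Ψ-sym p) (inflated-symmetric L Ψ-sym q)

  module Distinct (B : ℕ) (δ : ℕ → ℕ → Carrier)
                  (δ-refl : ∀ i → δ i i ≈ 1#)
                  (δ-≢ : ∀ {i j} → i < B → j < B → i ≢ j → δ i j ≈ 0#) where

    -- Distinctness is tested by a product of factors `1# - δ i j` and not by a decision, so that it
    -- becomes polynomial once `δ` is a character sum. Such a sum sees indices only modulo n, which
    -- is why `δ-≢` is confined to indices below `B`.
    avoids : ℕ → List ℕ → Carrier
    avoids i []      = 1#
    avoids i (j ∷ M) = (1# - δ i j) * avoids i M

    -- The innermost sum runs over the head with all other letters fixed. This is the order in which
    -- `integrate` can eliminate one variable at a time.
    distinct : ℕ → ℕ → Functional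
    distinct N zero    Ψ = Ψ []
    distinct N (suc s) Ψ = distinct N s (λ M → sum {N} λ i → avoids (toℕ i) M * Ψ (toℕ i ∷ M))

    distinct-linear : ∀ N s → Linear (distinct N s)
    distinct-linear N zero    = evaluation-linear []
    distinct-linear N (suc s) = ∘-linear (distinct-linear N s) λ M →
      sum-linear {N} λ i → *-linear (avoids (toℕ i) M) (evaluation-linear (toℕ i ∷ M))

    distinct-cong-< : ∀ N s {Ψ Ψ′} → (∀ {M} → All (_< N) M → Ψ M ≈ Ψ′ M) →
                      distinct N s Ψ ≈ distinct N s Ψ′
    distinct-cong-< N zero    Ψ≈Ψ′ = Ψ≈Ψ′ []
    distinct-cong-< N (suc s) Ψ≈Ψ′ = distinct-cong-< N s λ M<N →
      sum-cong-≋ {N} λ i → *-congˡ (Ψ≈Ψ′ (toℕ<n i ∷ M<N))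

    1-0≈1 : ∀ {x} → x ≈ 0# → 1# - x ≈ 1#
    1-0≈1 {x} x≈0 = begin
      1# - x        ≈⟨ +-identityʳ _ ⟨
      1# - x + 0#   ≈⟨ +-congˡ x≈0 ⟨
      1# - x + x    ≈⟨ +-assoc _ _ _ ⟩
      1# + (- x + x) ≈⟨ +-congˡ (-‿inverseˡ x) ⟩
      1# + 0#       ≈⟨ +-identityʳ _ ⟩
      1#            ∎

    avoids-hit : ∀ i M → avoids i (i ∷ M) ≈ 0#
    avoids-hit i M = trans (*-congʳ (trans (+-congˡ (-‿cong (δ-refl i))) (-‿inverseʳ 1#))) (zeroˡ _)

    avoids-miss : ∀ {i j} → i < B → j < B → i ≢ j → ∀ M → avoids i (j ∷ M) ≈ avoids i M
    avoids-miss i<B j<B i≢j M = trans (*-congʳ (1-0≈1 (δ-≢ i<B j<B i≢j))) (*-identityˡ _)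

    avoids-smaller : ∀ {N} → N < B → ∀ {M} → All (_< N) M → avoids N M ≈ 1#
    avoids-smaller N<B []                  = refl
    avoids-smaller N<B {j ∷ M} (j<N ∷ M<N) =
      trans (avoids-miss N<B (ℕ.<-trans j<N N<B) (ℕ.<⇒≢ j<N ∘ ≡.sym) M) (avoids-smaller N<B M<N)

    avoids-symmetric : ∀ i → Symmetric (avoids i)
    avoids-symmetric i ↭.refl         = refl
    avoids-symmetric i (↭.prep j p)   = *-congˡ (avoids-symmetric i p)
    avoids-symmetric i (↭.swap j k p) =
      trans (*-congˡ (*-congˡ (avoids-symmetric i p))) (a*[b*c]≈b*[a*c] _ _ _)
    avoids-symmetric i (↭.trans p q)  = trans (avoids-symmetric i p) (avoids-symmetric i q)

    -- A word of distinct letters contains the top letter `N` at most once, and by symmetry each of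
    -- the `suc s` positions for it contributes the same.
    distinct-suc : ∀ {N} → N < B → ∀ s {Ψ} → Symmetric Ψ →
      distinct (suc N) (suc s) Ψ ≈ distinct N (suc s) Ψ + suc s · distinct N s (Ψ ∘ (N ∷_))
    distinct-suc {N} N<B s {Ψ} Ψ-sym = begin
      distinct (suc N) s (λ M → sum {suc N} λ i → avoids (toℕ i) M * Ψ (toℕ i ∷ M))
        ≈⟨ cong (distinct-linear (suc N) s) (λ M → sum-last N λ i → avoids i M * Ψ (i ∷ M)) ⟩
      distinct (suc N) s (λ M → U M + V M)  ≈⟨ step s ⟩
      distinct N s U + suc s · distinct N s (Ψ ∘ (N ∷_)) ∎
      where
      U V : List ℕ → Carrier
      U M = sum {N} λ i → avoids (toℕ i) M * Ψ (toℕ i ∷ M)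
      V M = avoids N M * Ψ (N ∷ M)

      UV-sym : Symmetric (λ M → U M + V M)
      UV-sym p = +-cong
        (sum-cong-≋ {N} λ i → *-cong (avoids-symmetric (toℕ i) p) (Ψ-sym (↭.prep (toℕ i) p)))
        (*-cong (avoids-symmetric N p) (Ψ-sym (↭.prep N p)))

      V≈Ψ : ∀ s → distinct N s V ≈ distinct N s (Ψ ∘ (N ∷_))
      V≈Ψ s = distinct-cong-< N s λ M<N →
        trans (*-congʳ (avoids-smaller N<B M<N)) (*-identityˡ _)

      UV-N : ∀ M → U (N ∷ M) + V (N ∷ M) ≈ sum {N} λ i → avoids (toℕ i) M * Ψ (N ∷ toℕ i ∷ M)
      UV-N M = trans
        (+-cong
          (sum-cong-≋ {N} λ i → *-cong
            (avoids-miss (ℕ.<-trans (toℕ<n i) N<B) N<B (ℕ.<⇒≢ (toℕ<n i)) M)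
            (Ψ-sym (↭.swap (toℕ i) N ↭.refl)))
          (trans (*-congʳ (avoids-hit N M)) (zeroˡ _)))
        (+-identityʳ _)

      step : ∀ s → distinct (suc N) s (λ M → U M + V M) ≈
                   distinct N s U + suc s · distinct N s (Ψ ∘ (N ∷_))
      step zero    = +-congˡ (trans (V≈Ψ zero) (sym (+-identityʳ _)))
      -- The head is below `N` in `U` and equal to `N` in `V`. Since `U + V` is again symmetric, the
      -- induction hypothesis for shorter words looks for `N` in the tail, where `V` vanishes; `V`
      -- itself supplies the remaining copy.
      step (suc s) = begin
        distinct (suc N) (suc s) (λ M → U M + V M)
          ≈⟨ distinct-suc N<B s UV-sym ⟩
        distinct N (suc s) (λ M → U M + V M) + suc s · distinct N s (λ M → U (N ∷ M) + V (N ∷ M))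
          ≈⟨ +-cong (trans (+-homo (distinct-linear N (suc s)) U V) (+-congˡ (V≈Ψ (suc s))))
                    (×-congʳ (suc s) (cong (distinct-linear N s) UV-N)) ⟩
        (distinct N (suc s) U + distinct N (suc s) (Ψ ∘ (N ∷_))) +
          suc s · distinct N (suc s) (Ψ ∘ (N ∷_))
          ≈⟨ +-assoc _ _ _ ⟩
        distinct N (suc s) U + suc (suc s) · distinct N (suc s) (Ψ ∘ (N ∷_))  ∎

    -- Both sides satisfy a recursion on whether the top letter occurs. The factor `suc s` of
    -- `distinct-suc` is what carries `s !` to `suc s !`.
    distinct≈!strict : ∀ {N} → N ≤ B → ∀ s {Ψ} → Symmetric Ψ →
                       distinct N s Ψ ≈ (s !) · strict N s Ψ
    distinct≈!strict N≤B zero Ψ-sym = sym (+-identityʳ _)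
    distinct≈!strict {zero} N≤B (suc s) {Ψ} Ψ-sym =
      trans (0-homo (distinct-linear 0 s) λ _ → refl) (sym (·-zero (suc s !)))
      where
      ·-zero : ∀ n → n · 0# ≈ 0#
      ·-zero zero    = refl
      ·-zero (suc n) = trans (+-identityˡ _) (·-zero n)
    distinct≈!strict {suc N} N<B (suc s) {Ψ} Ψ-sym = begin
      distinct (suc N) (suc s) Ψ
        ≈⟨ distinct-suc N<B s Ψ-sym ⟩
      distinct N (suc s) Ψ + suc s · distinct N s (Ψ ∘ (N ∷_))
        ≈⟨ +-cong (distinct≈!strict (ℕ.<⇒≤ N<B) (suc s) Ψ-sym)
                  (trans (×-congʳ (suc s) (distinct≈!strict (ℕ.<⇒≤ N<B) s (Ψ-sym ∘ ↭.prep N)))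
                         (×-assocˡ _ (suc s) (s !))) ⟩
      (suc s !) · strict N (suc s) Ψ + (suc s !) · strict N s (Ψ ∘ (N ∷_))
        ≈⟨ ·-distribˡ-+ (suc s !) _ _ ⟨
      (suc s !) · (strict N (suc s) Ψ + strict N s (Ψ ∘ (N ∷_)))
        ≈⟨ ×-congʳ (suc s !) (sum-last N λ i → strict i s (Ψ ∘ (i ∷_))) ⟨
      (suc s !) · strict (suc N) (suc s) Ψ  ∎

  -- Indexing by positions makes the lemmas on sums over `Fin` apply, above all the interchange
  -- `∑-comm`.
  sumₗ : ∀ {a} {A : Set a} → List A → (A → Carrier) → Carrier
  sumₗ xs f = sum (f ∘ List.lookup xs)

  sumₗ-++ : ∀ {a} {A : Set a} (xs ys : List A) (f : A → Carrier) →
            sumₗ (xs ++ ys) f ≈ sumₗ xs f + sumₗ ys f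
  sumₗ-++ []       ys f = sym (+-identityˡ _)
  sumₗ-++ (x ∷ xs) ys f = trans (+-congˡ (sumₗ-++ xs ys f)) (sym (+-assoc _ _ _))

  sumₗ-map : ∀ {a b} {A : Set a} {B : Set b} (g : A → B) xs (f : B → Carrier) →
             sumₗ (List.map g xs) f ≈ sumₗ xs (f ∘ g)
  sumₗ-map g []       f = refl
  sumₗ-map g (x ∷ xs) f = +-congˡ (sumₗ-map g xs f)

  sumₗ-vectors : ∀ {a} {A : Set a} (xs : List A) l (f : Vec A (suc l) → Carrier) →
                 sumₗ (vectors xs (suc l)) f ≈
                 sumₗ xs λ x → sumₗ (vectors xs l) λ v → f (x ∷ v)
  sumₗ-vectors xs l f = product xs
    where
    product : ∀ ys → sumₗ (cartesianProductWith _∷_ ys (vectors xs l)) f ≈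
                     sumₗ ys λ y → sumₗ (vectors xs l) λ v → f (y ∷ v)
    product []       = refl
    product (y ∷ ys) = trans (sumₗ-++ (List.map (y ∷_) (vectors xs l)) _ f)
                             (+-cong (sumₗ-map (y ∷_) (vectors xs l) f) (product ys))

  -- From fillings of the boxes to weakly decreasing words

  weightOf : (ℕ → ℕ → Carrier) → ∀ {l} → Vec ℕ l → List ℕ → Carrier
  weightOf f []       []      = 1#
  weightOf f []       (_ ∷ _) = 0#
  weightOf f (_ ∷ _)  []      = 0#
  weightOf f (k ∷ ks) (m ∷ M) = f k m * weightOf f ks M

  strictOf : (ℕ → ℕ → Carrier) → ℕ → List ℕ → Carrier
  strictOf f N []       = 1#
  strictOf f N (k ∷ ks) = sum {N} λ i → f k (toℕ i) * strictOf f (toℕ i) ks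

  -- Merging two entries with "+" and with "-1+" together multiplies their factors.

  fillings≈weak : ∀ {f B} →
    (∀ {a b i} → 1 ≤ a → 1 ≤ b → i < B → f (a ℕ.+ b) i + f (a ℕ.∸ 1 ℕ.+ b) i ≈ f a i * f b i) →
    ∀ {N} → N ≤ B → ∀ w {a l} {ks : Vec ℕ l} → 1 ≤ a → VecAll.All (1 ≤_) ks →
    (sumₗ (vectors boxes l) λ □s → w (length (fill a □s ks)) * strictOf f N (fill a □s ks)) ≈
    sum {N} λ i → f a (toℕ i) * weak (toℕ i) (w ∘ suc) l (weightOf f ks)
  fillings≈weak {f} {B} f-merge {N} N≤B w {a} {ks = []} 1≤a [] = begin
    w 1 * (sum {N} λ i → f a (toℕ i) * 1#) + 0#
      ≈⟨ +-identityʳ _ ⟩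
    w 1 * (sum {N} λ i → f a (toℕ i) * 1#)
      ≈⟨ *-distribˡ-sum {N} (w 1) (λ i → f a (toℕ i) * 1#) ⟩
    (sum {N} λ i → w 1 * (f a (toℕ i) * 1#))
      ≈⟨ sum-cong-≋ {N} (λ i → a*[b*c]≈b*[a*c] _ _ _) ⟩
    (sum {N} λ i → f a (toℕ i) * (w 1 * 1#))  ∎
  fillings≈weak {f} {B} f-merge {N} N≤B w {a} {suc l} {k ∷ ks} 1≤a (1≤k ∷ 1≤ks) = begin
    (sumₗ (vectors boxes (suc l)) λ □s → w (length (fill a □s (k ∷ ks))) * strictOf f N (fill a □s (k ∷ ks)))
      ≈⟨ sumₗ-vectors boxes l (λ □s → w (length (fill a □s (k ∷ ks))) * strictOf f N (fill a □s (k ∷ ks))) ⟩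
    (sumₗ (vectors boxes l) λ □s → w (suc (length (fill k □s ks))) * sum {N} λ i → f a (toℕ i) * z (toℕ i) □s)
      + (_ + (_ + 0#))
      -- A comma makes the next index strictly smaller. The two merged fillings keep a single index,
      -- and `f-merge` turns their sum into the case of two equal indices.
      ≈⟨ +-cong commas (+-cong (fillings≈weak f-merge N≤B w (ℕ.≤-trans 1≤a (ℕ.m≤m+n a k)) 1≤ks)
           (trans (+-identityʳ _) (fillings≈weak f-merge N≤B w (ℕ.≤-trans 1≤k (ℕ.m≤n+m k (a ℕ.∸ 1))) 1≤ks))) ⟩
    (sum {N} λ i → f a (toℕ i) * below (toℕ i)) +
    ((sum {N} λ i → f (a ℕ.+ k) (toℕ i) * same (toℕ i)) +
     (sum {N} λ i → f (a ℕ.∸ 1 ℕ.+ k) (toℕ i) * same (toℕ i)))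
      ≈⟨ trans (+-congˡ (sym (∑-distrib-+ {N} (λ i → f (a ℕ.+ k) (toℕ i) * same (toℕ i))
                                              (λ i → f (a ℕ.∸ 1 ℕ.+ k) (toℕ i) * same (toℕ i)))))
               (sym (∑-distrib-+ {N} (λ i → f a (toℕ i) * below (toℕ i)) (λ i →
                 f (a ℕ.+ k) (toℕ i) * same (toℕ i) + f (a ℕ.∸ 1 ℕ.+ k) (toℕ i) * same (toℕ i)))) ⟩
    (sum {N} λ i → f a (toℕ i) * below (toℕ i) +
      (f (a ℕ.+ k) (toℕ i) * same (toℕ i) + f (a ℕ.∸ 1 ℕ.+ k) (toℕ i) * same (toℕ i)))
      ≈⟨ sum-cong-≋ {N} (λ i → regroup (<B i)) ⟩
    (sum {N} λ i → f a (toℕ i) * weak (toℕ i) (w ∘ suc) (suc l) (weightOf f (k ∷ ks)))  ∎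
    where
    z : ℕ → Vec Box l → Carrier
    z i □s = strictOf f i (fill k □s ks)

    same below : ℕ → Carrier
    same i  = weak i (w ∘ suc) l (weightOf f ks)
    below i = sum {i} λ j → f k (toℕ j) * weak (toℕ j) (w ∘ (2 ℕ.+_)) l (weightOf f ks)

    K : ℕ
    K = length (vectors boxes l)

    at : Fin K → Vec Box l
    at = List.lookup (vectors boxes l)

    w′ : Vec Box l → Carrier
    w′ □s = w (suc (length (fill k □s ks)))

    <B : (i : Fin N) → toℕ i < B
    <B i = ℕ.<-≤-trans (toℕ<n i) N≤B

    commas : (sumₗ (vectors boxes l) λ □s → w′ □s * sum {N} λ i → f a (toℕ i) * z (toℕ i) □s) ≈
             sum {N} λ i → f a (toℕ i) * below (toℕ i)
    commas = begin
      (sum {K} λ b → w′ (at b) * sum {N} λ i → f a (toℕ i) * z (toℕ i) (at b))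
        ≈⟨ sum-cong-≋ {K} (λ b → *-distribˡ-sum {N} _ _) ⟩
      (sum {K} λ b → sum {N} λ i → w′ (at b) * (f a (toℕ i) * z (toℕ i) (at b)))
        ≈⟨ ∑-comm {K} {N} (λ b i → w′ (at b) * (f a (toℕ i) * z (toℕ i) (at b))) ⟩
      (sum {N} λ i → sum {K} λ b → w′ (at b) * (f a (toℕ i) * z (toℕ i) (at b)))
        ≈⟨ sum-cong-≋ {N} (λ i → trans (sum-cong-≋ {K} λ b → a*[b*c]≈b*[a*c] _ _ _)
             (sym (*-distribˡ-sum {K} (f a (toℕ i)) λ b → w′ (at b) * z (toℕ i) (at b)))) ⟩
      (sum {N} λ i → f a (toℕ i) * sum {K} λ b → w′ (at b) * z (toℕ i) (at b))
        ≈⟨ sum-cong-≋ {N} (λ i → *-congˡ (fillings≈weak f-merge (ℕ.<⇒≤ (<B i)) (w ∘ suc) 1≤k 1≤ks)) ⟩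
      (sum {N} λ i → f a (toℕ i) * below (toℕ i))  ∎

    regroup : ∀ {i} → i < B → f a i * below i + (f (a ℕ.+ k) i * same i + f (a ℕ.∸ 1 ℕ.+ k) i * same i) ≈
                    f a i * weak i (w ∘ suc) (suc l) (weightOf f (k ∷ ks))
    regroup {i} i<B = begin
      f a i * below i + (f (a ℕ.+ k) i * same i + f (a ℕ.∸ 1 ℕ.+ k) i * same i)
        ≈⟨ +-congˡ (trans (sym (distribʳ _ _ _)) (*-congʳ (f-merge 1≤a 1≤k i<B))) ⟩
      f a i * below i + f a i * f k i * same i
        ≈⟨ solve 4 (λ a b c d → a :* b :+ a :* c :* d := a :* (c :* d :+ b)) refl _ _ _ _ ⟩
      f a i * (f k i * same i + below i)
        ≈⟨ *-congˡ (+-cong (*-homo (weak-linear i (w ∘ suc) l) (f k i) (weightOf f ks))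
             (sum-cong-≋ {i} λ j → *-homo (weak-linear (toℕ j) (w ∘ (2 ℕ.+_)) l) (f k (toℕ j)) (weightOf f ks))) ⟨
      f a i * weak i (w ∘ suc) (suc l) (weightOf f (k ∷ ks))  ∎

  -- Words whose letters carry independent labels from an alphabet

  module Labelled (f : ℕ → ℕ → Carrier) (alphabet : List ℕ) where

    -- With `χ` the indicator of an index set, this is the sum over its multi-indices of the
    -- products of `f kᵢ mᵢ`. Taking one letter at a time lets a block of equal letters be peeled
    -- off.
    labelled : (List ℕ → Carrier) → List ℕ → Carrier
    labelled χ []      = χ []
    labelled χ (m ∷ M) = sumₗ alphabet λ a → f a m * labelled (χ ∘ (a ∷_)) M

    labelled-supported : ∀ {l χ} → SupportedOn l χ → SupportedOn l (labelled χ)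
    labelled-supported χ-supp [] 0≢l = χ-supp [] 0≢l
    labelled-supported {l} {χ} χ-supp (m ∷ M) |M|≢l = sum-zero {length alphabet} λ i →
      trans (*-congˡ (vanish M {χ = χ ∘ (List.lookup alphabet i ∷_)}
              λ ks |ks|≡|M| → χ-supp _ (|M|≢l ∘ ≡.trans (≡.cong suc (≡.sym |ks|≡|M|)))))
            (zeroʳ _)
      where
      vanish : ∀ M {χ} → (∀ ks → length ks ≡ length M → χ ks ≈ 0#) → labelled χ M ≈ 0#
      vanish []      χ≈0 = χ≈0 [] ≡.refl
      vanish (m ∷ M) χ≈0 = sum-zero {length alphabet} λ i →
        trans (*-congˡ (vanish M λ ks → χ≈0 _ ∘ ≡.cong suc)) (zeroʳ _)

    labelled≈sum : ∀ l {χ} → SupportedOn l χ → ∀ M →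
      (sumₗ (vectors alphabet l) λ ks → χ (toList ks) * weightOf f ks M) ≈ labelled χ M
    labelled≈sum zero    χ-supp []      = trans (+-identityʳ _) (*-identityʳ _)
    labelled≈sum zero    χ-supp (m ∷ M) = trans (+-identityʳ _) (trans (zeroʳ _)
      (sym (labelled-supported χ-supp (m ∷ M) λ ())))
    labelled≈sum (suc l) {χ} χ-supp []  = trans
      (sumₗ-vectors alphabet l λ ks → χ (toList ks) * weightOf f ks [])
      (trans (sum-zero {length alphabet} λ i → sum-zero {length (vectors alphabet l)} λ j → zeroʳ _)
             (sym (χ-supp [] λ ())))
    labelled≈sum (suc l) {χ} χ-supp (m ∷ M) = trans
      (sumₗ-vectors alphabet l λ ks → χ (toList ks) * weightOf f ks (m ∷ M))
      (sum-cong-≋ {length alphabet} λ i → let a = List.lookup alphabet i in begin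
        (sumₗ (vectors alphabet l) λ ks → χ (a ∷ toList ks) * (f a m * weightOf f ks M))
          ≈⟨ sum-cong-≋ {length (vectors alphabet l)} (λ j → a*[b*c]≈b*[a*c] _ _ _) ⟩
        (sumₗ (vectors alphabet l) λ ks → f a m * (χ (a ∷ toList ks) * weightOf f ks M))
          ≈⟨ *-distribˡ-sum {length (vectors alphabet l)} _ _ ⟨
        f a m * (sumₗ (vectors alphabet l) λ ks → χ (a ∷ toList ks) * weightOf f ks M)
          ≈⟨ *-congˡ (labelled≈sum l (supportedOn-∷ a χ-supp) M) ⟩
        f a m * labelled (χ ∘ (a ∷_)) M  ∎)

    labelled-cong : ∀ {χ χ′} → (∀ ks → χ ks ≈ χ′ ks) → ∀ M → labelled χ M ≈ labelled χ′ M
    labelled-cong χ≈χ′ []      = χ≈χ′ []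
    labelled-cong χ≈χ′ (m ∷ M) = sum-cong-≋ {length alphabet} λ i →
      *-congˡ (labelled-cong (λ ks → χ≈χ′ _) M)

    -- Permuting the letters is compensated by permuting the labels along with them; here the
    -- stability of the index set under permutation is used.
    labelled-symmetric : ∀ {χ} → Symmetric χ → Symmetric (labelled χ)
    labelled-symmetric χ-sym ↭.refl       = refl
    labelled-symmetric χ-sym (↭.prep m p) = sum-cong-≋ {length alphabet} λ i →
      *-congˡ (labelled-symmetric (χ-sym ∘ ↭.prep _) p)
    labelled-symmetric {χ} χ-sym (↭.swap {xs = M} {ys = M′} m m′ p) = begin
      (sumₗ alphabet λ a → f a m * sumₗ alphabet λ b → f b m′ * labelled (χ₂ a b) M)
        ≈⟨ sum-cong-≋ {k} (λ i → *-distribˡ-sum {k} _ _) ⟩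
      (sumₗ alphabet λ a → sumₗ alphabet λ b → f a m * (f b m′ * labelled (χ₂ a b) M))
        ≈⟨ ∑-comm {k} {k} (λ i j → f (at i) m * (f (at j) m′ * labelled (χ₂ (at i) (at j)) M)) ⟩
      (sumₗ alphabet λ b → sumₗ alphabet λ a → f a m * (f b m′ * labelled (χ₂ a b) M))
        ≈⟨ sum-cong-≋ {k} (λ j → sum-cong-≋ {k} λ i → trans (a*[b*c]≈b*[a*c] _ _ _)
             (*-congˡ (*-congˡ (trans (labelled-symmetric (χ-sym ∘ ↭.prep _ ∘ ↭.prep _) p)
               (labelled-cong (λ ks → χ-sym (↭.swap _ _ ↭.refl)) M′))))) ⟩
      (sumₗ alphabet λ b → sumₗ alphabet λ a → f b m′ * (f a m * labelled (χ₂ b a) M′))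
        ≈⟨ sum-cong-≋ {k} (λ j → *-distribˡ-sum {k} _ _) ⟨
      (sumₗ alphabet λ b → f b m′ * sumₗ alphabet λ a → f a m * labelled (χ₂ b a) M′)  ∎
      where
      k : ℕ
      k = length alphabet

      at : Fin k → ℕ
      at = List.lookup alphabet

      χ₂ : ℕ → ℕ → List ℕ → Carrier
      χ₂ a b ks = χ (a ∷ b ∷ ks)
    labelled-symmetric χ-sym (↭.trans p q) =
      trans (labelled-symmetric χ-sym p) (labelled-symmetric χ-sym q)

  -- Functions of indices m₁,…,mₛ that are polynomials in x m₁,…,x mₛ

  module Polynomial {p} (P : Carrier → Set p)
                    (P-resp : ∀ {a b} → a ≈ b → P a → P b)
                    (P-0 : P 0#) (P-1 : P 1#)
                    (P-+ : ∀ {a b} → P a → P b → P (a + b))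
                    (P-* : ∀ {a b} → P a → P b → P (a * b))
                    (x : ℕ → Carrier) where

    -- The first variable is singled out: a derivation lists powers of the first `x m`, each with a
    -- coefficient polynomial in the later variables. Summing over that index then merely replaces
    -- each power by a power sum.
    data IsPolynomial : ∀ s → (Vec ℕ s → Carrier) → Set (c ⊔ ℓ ⊔ p) where
      const : ∀ {T} → P (T []) → IsPolynomial 0 T
      null  : ∀ {s T} → (∀ v → T v ≈ 0#) → IsPolynomial (suc s) T
      term  : ∀ {s T} j {T₀ T₁} → IsPolynomial s T₀ → IsPolynomial (suc s) T₁ →
              (∀ m ms → T (m ∷ ms) ≈ x m ^ j * T₀ ms + T₁ (m ∷ ms)) → IsPolynomial (suc s) T

    resp : ∀ {s T U} → (∀ v → T v ≈ U v) → IsPolynomial s T → IsPolynomial s U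
    resp T≈U (const t)        = const (P-resp (T≈U []) t)
    resp T≈U (null T≈0)       = null λ v → trans (sym (T≈U v)) (T≈0 v)
    resp T≈U (term j t₀ t₁ e) = term j t₀ t₁ λ m ms → trans (sym (T≈U (m ∷ ms))) (e m ms)

    constant : ∀ s {a} → P a → IsPolynomial s (λ _ → a)
    constant zero    a∈P = const a∈P
    constant (suc s) a∈P = term 0 (constant s a∈P) (null {T = λ _ → 0#} λ _ → refl)
      λ m ms → sym (trans (+-identityʳ _) (*-identityˡ _))

    monomial : ∀ s j → IsPolynomial (suc s) (λ v → x (Vec.head v) ^ j)
    monomial s j = term j (constant s P-1) (null {T = λ _ → 0#} λ _ → refl)
      λ m ms → sym (trans (+-identityʳ _) (*-identityʳ _))

    weaken : ∀ {s T} → IsPolynomial s T → IsPolynomial (suc s) (T ∘ Vec.tail)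
    weaken t = term 0 t (null {T = λ _ → 0#} λ _ → refl)
      λ m ms → sym (trans (+-identityʳ _) (*-identityˡ _))

    weaken₂ : ∀ {s T} → IsPolynomial (suc s) T →
              IsPolynomial (2 ℕ.+ s) (λ v → T (Vec.head v ∷ Vec.tail (Vec.tail v)))
    weaken₂ (null T≈0)       = null λ v → T≈0 _
    weaken₂ (term j t₀ t₁ e) = term j (weaken t₀) (weaken₂ t₁) λ { m (m′ ∷ ms) → e m ms }

    _⊕_ : ∀ {s T U} → IsPolynomial s T → IsPolynomial s U → IsPolynomial s (λ v → T v + U v)
    const t        ⊕ const u = const (P-+ t u)
    null T≈0       ⊕ u       = resp (λ v → sym (trans (+-congʳ (T≈0 v)) (+-identityˡ _))) u
    term j t₀ t₁ e ⊕ u       = term j t₀ (t₁ ⊕ u) λ m ms → trans (+-congʳ (e m ms)) (+-assoc _ _ _)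

    _⊗_      : ∀ {s T U} → IsPolynomial s T → IsPolynomial s U → IsPolynomial s (λ v → T v * U v)
    scale    : ∀ {s T₀ U} j → IsPolynomial s T₀ → IsPolynomial (suc s) U →
               IsPolynomial (suc s) (λ v → x (Vec.head v) ^ j * T₀ (Vec.tail v) * U v)

    const t        ⊗ const u = const (P-* t u)
    null T≈0       ⊗ u       = null λ v → trans (*-congʳ (T≈0 v)) (zeroˡ _)
    term j t₀ t₁ e ⊗ u       = resp
      (λ { (m ∷ ms) → sym (trans (*-congʳ (e m ms)) (distribʳ _ _ _)) })
      (scale j t₀ u ⊕ (t₁ ⊗ u))

    scale j t₀ (null U≈0)        = null λ v → trans (*-congˡ (U≈0 v)) (zeroʳ _)
    scale j t₀ (term i u₀ u₁ e) = term (j ℕ.+ i) (t₀ ⊗ u₀) (scale j t₀ u₁) λ m ms →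
      trans (*-congˡ (e m ms)) (trans (distribˡ _ _ _) (+-congʳ (trans
        (solve 4 (λ a b c d → a :* b :* (c :* d) := a :* c :* (b :* d)) refl _ _ _ _)
        (*-congʳ (sym (^-homo-* (x m) j i))))))

    sum-poly : ∀ {s n} {T : Fin n → Vec ℕ s → Carrier} →
               (∀ i → IsPolynomial s (T i)) → IsPolynomial s (λ v → sum λ i → T i v)
    sum-poly {n = zero}      t = constant _ P-0
    sum-poly {n = suc n} {T} t = t zero ⊕ sum-poly {T = T ∘ suc} (t ∘ suc)

    power : ∀ {s T} n → IsPolynomial s T → IsPolynomial s (λ v → T v ^ n)
    power zero    t = constant _ P-1
    power (suc n) t = t ⊗ power n t

    -- Summing out the variables

    module _ (B : ℕ) (power-sums : ∀ j → P (sum {B} λ i → x (toℕ i) ^ j)) where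

      integrate : ∀ {s T} → IsPolynomial (suc s) T → IsPolynomial s (λ ms → sum {B} λ i → T (toℕ i ∷ ms))
      integrate {s} (null T≈0) =
        resp (λ ms → sym (sum-zero {B} λ i → T≈0 _)) (constant s P-0)
      integrate {s} {T} (term j {T₀} {T₁} t₀ t₁ e) = resp
        (λ ms → sym (begin
          (sum {B} λ i → T (toℕ i ∷ ms))
            ≈⟨ sum-cong-≋ {B} (λ i → e (toℕ i) ms) ⟩
          (sum {B} λ i → x (toℕ i) ^ j * T₀ ms + T₁ (toℕ i ∷ ms))
            ≈⟨ ∑-distrib-+ {B} (λ i → x (toℕ i) ^ j * T₀ ms) (λ i → T₁ (toℕ i ∷ ms)) ⟩
          (sum {B} λ i → x (toℕ i) ^ j * T₀ ms) + (sum {B} λ i → T₁ (toℕ i ∷ ms))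
            ≈⟨ +-congʳ (*-distribʳ-sum {B} (T₀ ms) λ i → x (toℕ i) ^ j) ⟨
          (sum {B} λ i → x (toℕ i) ^ j) * T₀ ms + (sum {B} λ i → T₁ (toℕ i ∷ ms))  ∎))
        ((constant s (power-sums j) ⊗ t₀) ⊕ integrate t₁)

      module _ (δ : ℕ → ℕ → Carrier)
               (δ-refl : ∀ i → δ i i ≈ 1#)
               (δ-≢ : ∀ {i j} → i < B → j < B → i ≢ j → δ i j ≈ 0#)
               (P-neg : ∀ {a} → P a → P (- a))
               (δ-poly : ∀ s → IsPolynomial (2 ℕ.+ s) (λ v → δ (Vec.head v) (Vec.head (Vec.tail v))))
               (P-÷ : ∀ n .{{_ : ℕ.NonZero n}} {a} → P (n · a) → P a) where

        open Distinct B δ δ-refl δ-≢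

        avoids-poly : ∀ s → IsPolynomial (suc s) (λ v → avoids (Vec.head v) (toList (Vec.tail v)))
        avoids-poly zero    = resp (λ { (m ∷ []) → refl }) (constant 1 P-1)
        avoids-poly (suc s) = resp
          (λ { (m ∷ m′ ∷ ms) → *-congʳ (+-congˡ (-1*x≈-x _)) })
          ((constant _ P-1 ⊕ (constant _ (P-neg P-1) ⊗ δ-poly s)) ⊗ weaken₂ (avoids-poly s))

        distinct-P : ∀ s {Ψ} → IsPolynomial s (Ψ ∘ toList) → P (distinct B s Ψ)
        distinct-P zero    (const ψ) = ψ
        distinct-P (suc s) {Ψ} ψ = distinct-P s
          (integrate {T = λ v → avoids (Vec.head v) (toList (Vec.tail v)) * Ψ (toList v)} (avoids-poly s ⊗ ψ))

        -- Symmetry trades the order of the indices for their distinctness, which is polynomial by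
        -- `avoids-poly`. The price is the factor `s !`, removed by `P-÷`.
        strict-P : ∀ s {Ψ} → Symmetric Ψ → IsPolynomial s (Ψ ∘ toList) → P (strict B s Ψ)
        strict-P s Ψ-sym ψ = P-÷ (s !) {{s ℕ.!≢0}}
          (P-resp (distinct≈!strict ℕ.≤-refl s Ψ-sym) (distinct-P s ψ))

        module _ (f : ℕ → ℕ → Carrier) (alphabet : List ℕ)
                 (f-poly : ∀ s a → IsPolynomial (suc s) (λ v → f a (Vec.head v))) where

          open Labelled f alphabet

          -- A block of equal letters contributes products of values of `f` at one index, hence a
          -- polynomial in one variable. The claim is for all `χ` because each label peeled off is
          -- absorbed into `χ` as a prefix.
          inflated-labelled-poly : ∀ s L {χ} → (∀ ks → P (χ ks)) →
                                   IsPolynomial s (inflated L (labelled χ) ∘ toList)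
          inflated-labelled-poly zero    L χ∈P = const (χ∈P [])
          inflated-labelled-poly (suc s) L {χ} χ∈P = resp (λ { (m ∷ ms) → refl })
            (sum-poly {n = L} {T = λ c → block-sum (suc (toℕ c)) χ} λ c → block (suc (toℕ c)) χ∈P)
            where
            block-sum : ℕ → (List ℕ → Carrier) → Vec ℕ (suc s) → Carrier
            block-sum j χ v =
              inflate L (toList (Vec.tail v)) (λ M → labelled χ (replicate j (Vec.head v) ++ M))

            block : ∀ j {χ} → (∀ ks → P (χ ks)) → IsPolynomial (suc s) (block-sum j χ)
            block zero    χ∈P = weaken (inflated-labelled-poly s L χ∈P)
            block (suc j) {χ} χ∈P = resp
              -- Linearity of `inflate` takes the sum over the label of one copy of the head outside
              -- the sum over the remaining blocks.
              (λ v → sym (combination (inflate-linear L (toList (Vec.tail v))) {length alphabet}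
                     (λ i → f (List.lookup alphabet i) (Vec.head v))
                     (λ i M → labelled (χ ∘ (List.lookup alphabet i ∷_)) (replicate j (Vec.head v) ++ M))))
              (sum-poly {n = length alphabet} λ i →
                f-poly s (List.lookup alphabet i) ⊗ block j (χ∈P ∘ (List.lookup alphabet i ∷_)))

          weakly-decreasing-P : ∀ l {w χ} → (∀ s → P (w s)) → (∀ ks → P (χ ks)) →
            Symmetric χ → SupportedOn (suc l) χ →
            P (sum {B} λ i → weak (toℕ i) w l (labelled χ ∘ (toℕ i ∷_)))
          weakly-decreasing-P l {w} {χ} w∈P χ∈P χ-sym χ-supp =
            P-resp (sym (weakly-decreasing≈strict B w l (labelled-supported χ-supp)))
              (sum-P (suc l) λ s → P-* (w∈P (toℕ s))
                (strict-P (suc (toℕ s))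
                  (inflated-symmetric (suc l) (labelled-symmetric χ-sym))
                  (inflated-labelled-poly (suc (toℕ s)) (suc l) χ∈P)))
            where
            sum-P : ∀ n {f : Fin n → Carrier} → (∀ i → P (f i)) → P (sum f)
            sum-P zero    f∈P = P-0
            sum-P (suc n) f∈P = P-+ (f∈P zero) (sum-P n (f∈P ∘ suc))

-- Rational elements of a field of characteristic zero

module RationalElements {c ℓ₁ ℓ₂} (K : HeytingField c ℓ₁ ℓ₂) (char0 : OverField.CharZero K) where

  open HeytingField K using (_#_; #⇒invertible; heytingCommutativeRing)
  open HeytingCommutativeRing heytingCommutativeRing using (commutativeRing)
  open CommutativeRing commutativeRing hiding (zero)
  open OverField K using (1/[_]; fromℤ; fromℚ; _∈ℚ[t]_)
  open Algebra.Properties.Ring (CommutativeRing.ring commutativeRing)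
    using (-‿distribˡ-*; -0#≈0#; +-cancelʳ)
  open Algebra.Properties.Semiring.Mult semiring
    using (×-homo-+; ×1-homo-*; ×-assoc-*; ×-congʳ) renaming (_×_ to _·_)
  open Algebra.Solver.Ring.NaturalCoefficients.Default commutativeSemiring
    using (solve; _:=_; _:+_; _:*_)
  open Relation.Binary.Reasoning.Setoid setoid

  1/-inverse : ∀ {x y} (x#y : x # y) → 1/[ x#y ] * (x - y) ≈ 1#
  1/-inverse x#y = proj₁ (proj₂ (#⇒invertible x#y))

  ⟦_⟧ : ℕ → Carrier
  ⟦ n ⟧ = n · 1#

  _⁻¹ : ∀ n .{{_ : NonZero n}} → Carrier
  n ⁻¹ = 1/[ char0 n ]

  ⁻¹-inverse : ∀ n .{{_ : NonZero n}} → ⟦ n ⟧ * n ⁻¹ ≈ 1#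
  ⁻¹-inverse n = begin
    ⟦ n ⟧ * n ⁻¹         ≈⟨ *-comm _ _ ⟩
    n ⁻¹ * ⟦ n ⟧         ≈⟨ *-congˡ (+-identityʳ _) ⟨
    n ⁻¹ * (⟦ n ⟧ + 0#)  ≈⟨ *-congˡ (+-congˡ -0#≈0#) ⟨
    n ⁻¹ * (⟦ n ⟧ - 0#)  ≈⟨ 1/-inverse (char0 n) ⟩
    1#                   ∎

  ⟦⟧-cancelˡ : ∀ n .{{_ : NonZero n}} {a b} → ⟦ n ⟧ * a ≈ ⟦ n ⟧ * b → a ≈ b
  ⟦⟧-cancelˡ n {a} {b} na≈nb = begin
    a                    ≈⟨ undo a ⟨
    n ⁻¹ * (⟦ n ⟧ * a)   ≈⟨ *-congˡ na≈nb ⟩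
    n ⁻¹ * (⟦ n ⟧ * b)   ≈⟨ undo b ⟩
    b                    ∎
    where
    undo : ∀ a → n ⁻¹ * (⟦ n ⟧ * a) ≈ a
    undo a = trans (solve 3 (λ x y z → x :* (y :* z) := y :* x :* z) refl _ _ _)
                   (trans (*-congʳ (⁻¹-inverse n)) (*-identityˡ a))

  -- a = (p - q) / (d + 1), with the denominator and the sign cleared.

  Rational : Carrier → Set ℓ₁
  Rational a = ∃ λ d → ∃ λ p → ∃ λ q → ⟦ suc d ⟧ * a + ⟦ q ⟧ ≈ ⟦ p ⟧

  rational-resp : ∀ {a b} → a ≈ b → Rational a → Rational b
  rational-resp a≈b (d , p , q , e) = d , p , q , trans (+-congʳ (*-congˡ (sym a≈b))) e

  rational-⟦⟧ : ∀ n → Rational ⟦ n ⟧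
  rational-⟦⟧ n = 0 , n , 0 , trans (+-identityʳ _) (trans (*-congʳ (+-identityʳ 1#)) (*-identityˡ _))

  rational-0 : Rational 0#
  rational-0 = rational-⟦⟧ 0

  rational-1 : Rational 1#
  rational-1 = rational-resp (+-identityʳ 1#) (rational-⟦⟧ 1)

  ⟦⟧-homo-+ : ∀ m n → ⟦ m ℕ.+ n ⟧ ≈ ⟦ m ⟧ + ⟦ n ⟧
  ⟦⟧-homo-+ = ×-homo-+ 1#

  rational-+ : ∀ {a b} → Rational a → Rational b → Rational (a + b)
  rational-+ {a} {b} (d , p , q , e) (d′ , p′ , q′ , e′) =
    -- The successor of the first witness is `D ℕ.* D′` by computation. With the signs cleared, the
    -- identity below lies within reach of a solver for commutative semirings.
    d′ ℕ.+ d ℕ.* D′ , D′ ℕ.* p ℕ.+ D ℕ.* p′ , D′ ℕ.* q ℕ.+ D ℕ.* q′ , (begin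
      ⟦ D ℕ.* D′ ⟧ * (a + b) + ⟦ D′ ℕ.* q ℕ.+ D ℕ.* q′ ⟧
        ≈⟨ +-cong (*-congʳ (×1-homo-* D D′)) (bilinear q q′) ⟩
      ⟦ D ⟧ * ⟦ D′ ⟧ * (a + b) + (⟦ D′ ⟧ * ⟦ q ⟧ + ⟦ D ⟧ * ⟦ q′ ⟧)
        ≈⟨ solve 6 (λ D D′ a b q q′ → D :* D′ :* (a :+ b) :+ (D′ :* q :+ D :* q′) :=
             D′ :* (D :* a :+ q) :+ D :* (D′ :* b :+ q′)) refl ⟦ D ⟧ ⟦ D′ ⟧ a b ⟦ q ⟧ ⟦ q′ ⟧ ⟩
      ⟦ D′ ⟧ * (⟦ D ⟧ * a + ⟦ q ⟧) + ⟦ D ⟧ * (⟦ D′ ⟧ * b + ⟦ q′ ⟧)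
        ≈⟨ +-cong (*-congˡ e) (*-congˡ e′) ⟩
      ⟦ D′ ⟧ * ⟦ p ⟧ + ⟦ D ⟧ * ⟦ p′ ⟧
        ≈⟨ bilinear p p′ ⟨
      ⟦ D′ ℕ.* p ℕ.+ D ℕ.* p′ ⟧  ∎)
    where
    D D′ : ℕ
    D  = suc d
    D′ = suc d′

    bilinear : ∀ m n → ⟦ D′ ℕ.* m ℕ.+ D ℕ.* n ⟧ ≈ ⟦ D′ ⟧ * ⟦ m ⟧ + ⟦ D ⟧ * ⟦ n ⟧
    bilinear m n = trans (⟦⟧-homo-+ (D′ ℕ.* m) (D ℕ.* n)) (+-cong (×1-homo-* D′ m) (×1-homo-* D n))

  rational-* : ∀ {a b} → Rational a → Rational b → Rational (a * b)
  rational-* {a} {b} (d , p , q , e) (d′ , p′ , q′ , e′) =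
    -- The witnesses come from (p - q)(p′ - q′) = (pp′ + qq′) - (pq′ + qp′).
    d′ ℕ.+ d ℕ.* D′ , p ℕ.* p′ ℕ.+ q ℕ.* q′ , p ℕ.* q′ ℕ.+ q ℕ.* p′ , (begin
      ⟦ D ℕ.* D′ ⟧ * (a * b) + ⟦ p ℕ.* q′ ℕ.+ q ℕ.* p′ ⟧
        ≈⟨ +-cong (*-congʳ (×1-homo-* D D′)) (bilinear p q′ q p′) ⟩
      ⟦ D ⟧ * ⟦ D′ ⟧ * (a * b) + (⟦ p ⟧ * ⟦ q′ ⟧ + ⟦ q ⟧ * ⟦ p′ ⟧)
        ≈⟨ +-congˡ (+-cong (*-congʳ e) (*-congˡ e′)) ⟨
      ⟦ D ⟧ * ⟦ D′ ⟧ * (a * b) + ((⟦ D ⟧ * a + ⟦ q ⟧) * ⟦ q′ ⟧ + ⟦ q ⟧ * (⟦ D′ ⟧ * b + ⟦ q′ ⟧))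
        ≈⟨ solve 6 (λ D D′ a b q q′ →
             D :* D′ :* (a :* b) :+ ((D :* a :+ q) :* q′ :+ q :* (D′ :* b :+ q′)) :=
             (D :* a :+ q) :* (D′ :* b :+ q′) :+ q :* q′) refl ⟦ D ⟧ ⟦ D′ ⟧ a b ⟦ q ⟧ ⟦ q′ ⟧ ⟩
      (⟦ D ⟧ * a + ⟦ q ⟧) * (⟦ D′ ⟧ * b + ⟦ q′ ⟧) + ⟦ q ⟧ * ⟦ q′ ⟧
        ≈⟨ +-congʳ (*-cong e e′) ⟩
      ⟦ p ⟧ * ⟦ p′ ⟧ + ⟦ q ⟧ * ⟦ q′ ⟧
        ≈⟨ bilinear p p′ q q′ ⟨
      ⟦ p ℕ.* p′ ℕ.+ q ℕ.* q′ ⟧  ∎)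
    where
    D D′ : ℕ
    D  = suc d
    D′ = suc d′

    bilinear : ∀ k l m n → ⟦ k ℕ.* l ℕ.+ m ℕ.* n ⟧ ≈ ⟦ k ⟧ * ⟦ l ⟧ + ⟦ m ⟧ * ⟦ n ⟧
    bilinear k l m n = trans (⟦⟧-homo-+ (k ℕ.* l) (m ℕ.* n)) (+-cong (×1-homo-* k l) (×1-homo-* m n))

  rational-neg : ∀ {a} → Rational a → Rational (- a)
  rational-neg {a} (d , p , q , e) = d , q , p , (begin
    ⟦ suc d ⟧ * - a + ⟦ p ⟧                        ≈⟨ +-congˡ e ⟨
    ⟦ suc d ⟧ * - a + (⟦ suc d ⟧ * a + ⟦ q ⟧)
      ≈⟨ solve 4 (λ D x a q → D :* x :+ (D :* a :+ q) := D :* (x :+ a) :+ q) refl _ _ _ _ ⟩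
    ⟦ suc d ⟧ * (- a + a) + ⟦ q ⟧                  ≈⟨ +-congʳ (*-congˡ (-‿inverseˡ a)) ⟩
    ⟦ suc d ⟧ * 0# + ⟦ q ⟧                         ≈⟨ +-congʳ (zeroʳ _) ⟩
    0# + ⟦ q ⟧                                     ≈⟨ +-identityˡ _ ⟩
    ⟦ q ⟧                                          ∎)

  rational-÷ : ∀ n .{{_ : NonZero n}} {a} → Rational (n · a) → Rational a
  rational-÷ (suc n) {a} (d , p , q , e) = n ℕ.+ d ℕ.* suc n , p , q , (begin
    ⟦ suc d ℕ.* suc n ⟧ * a + ⟦ q ⟧
      ≈⟨ +-congʳ (trans (*-congʳ (×1-homo-* (suc d) (suc n))) (*-assoc _ _ _)) ⟩
    ⟦ suc d ⟧ * (⟦ suc n ⟧ * a) + ⟦ q ⟧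
      ≈⟨ +-congʳ (*-congˡ (trans (×-assoc-* (suc n) 1# a) (×-congʳ (suc n) (*-identityˡ a)))) ⟩
    ⟦ suc d ⟧ * (suc n · a) + ⟦ q ⟧
      ≈⟨ e ⟩
    ⟦ p ⟧  ∎)

  rational-⁻¹ : ∀ n .{{_ : NonZero n}} → Rational (n ⁻¹)
  rational-⁻¹ n = rational-÷ n (rational-resp
    (sym (trans (×-congʳ n (sym (*-identityˡ _))) (trans (sym (×-assoc-* n 1# _)) (⁻¹-inverse n))))
    rational-1)

  fromℤ-⊖ : ∀ p q → fromℤ (p ⊖ q) + ⟦ q ⟧ ≈ ⟦ p ⟧
  fromℤ-⊖ p       zero    = +-identityʳ _
  fromℤ-⊖ zero    (suc q) = -‿inverseˡ _
  fromℤ-⊖ (suc p) (suc q) rewrite ℤ.[1+m]⊖[1+n]≡m⊖n p q = begin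
    fromℤ (p ⊖ q) + (1# + ⟦ q ⟧)  ≈⟨ solve 3 (λ a b c → a :+ (b :+ c) := b :+ (a :+ c)) refl _ _ _ ⟩
    1# + (fromℤ (p ⊖ q) + ⟦ q ⟧)  ≈⟨ +-congˡ (fromℤ-⊖ p q) ⟩
    1# + ⟦ p ⟧                    ∎

  fromℤ-*-pos : ∀ z n → fromℤ (z ℤ.* + n) ≈ fromℤ z * ⟦ n ⟧
  fromℤ-*-pos (+ m)      n       = trans (reflexive (≡.cong fromℤ (≡.sym (ℤ.pos-* m n)))) (×1-homo-* m n)
  fromℤ-*-pos -[1+ m ]   zero    = trans (reflexive (≡.cong fromℤ (ℤ.*-zeroʳ -[1+ m ]))) (sym (zeroʳ _))
  fromℤ-*-pos -[1+ m ]   (suc n) = trans (-‿cong (×1-homo-* (suc m) (suc n))) (-‿distribˡ-* _ _)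

  -- `fromℚ` reads a reduced fraction, whose numerator and denominator differ from the given ones.
  -- The two fractions are compared by cross-multiplication, and the denominator `suc d` is
  -- cancelled in the field.
  rational⇒fromℚ : ∀ {a} → Rational a → ∃ λ u → a ≈ fromℚ char0 u
  rational⇒fromℚ {a} (d , p , q , e) = fromℚᵘ (mkℚᵘ (p ⊖ q) d) ,
    same (fromℚᵘ (mkℚᵘ (p ⊖ q) d)) (ℚ.toℚᵘ-fromℚᵘ (mkℚᵘ (p ⊖ q) d))
    where
    same : ∀ u → toℚᵘ u ≃ mkℚᵘ (p ⊖ q) d → a ≈ fromℚ char0 u
    same (mkℚ z d′ _) (*≡* eq) = ⟦⟧-cancelˡ (suc d) (begin
      ⟦ suc d ⟧ * a
        ≈⟨ +-cancelʳ ⟦ q ⟧ _ _ (trans e (sym (fromℤ-⊖ p q))) ⟩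
      fromℤ (p ⊖ q)
        ≈⟨ *-identityʳ _ ⟨
      fromℤ (p ⊖ q) * 1#
        ≈⟨ *-congˡ (⁻¹-inverse (suc d′)) ⟨
      fromℤ (p ⊖ q) * (⟦ suc d′ ⟧ * suc d′ ⁻¹)
        ≈⟨ trans (sym (*-assoc _ _ _)) (*-congʳ (sym (fromℤ-*-pos (p ⊖ q) (suc d′)))) ⟩
      fromℤ ((p ⊖ q) ℤ.* + suc d′) * suc d′ ⁻¹
        ≈⟨ *-congʳ (reflexive (≡.cong fromℤ eq)) ⟨
      fromℤ (z ℤ.* + suc d) * suc d′ ⁻¹
        ≈⟨ *-congʳ (fromℤ-*-pos z (suc d)) ⟩
      fromℤ z * ⟦ suc d ⟧ * suc d′ ⁻¹
        ≈⟨ solve 3 (λ a b c → a :* b :* c := b :* (a :* c)) refl _ _ _ ⟩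
      ⟦ suc d ⟧ * (fromℤ z * suc d′ ⁻¹)  ∎)

  rational-coefficients : ∀ p → (∀ i → Rational (coeff 0# p i)) → p ∈ℚ[t] char0
  rational-coefficients []      _   = [] , λ _ → refl
  rational-coefficients (a ∷ p) rat =
    let u , a≈u = rational⇒fromℚ (rat 0)
        P , p≈P = rational-coefficients p (rat ∘ suc)
    in u ∷ P , λ { zero → a≈u ; (suc i) → p≈P i }

-- Specialisation to a primitive root of unity

module RootsOfUnity {c ℓ₁ ℓ₂} (K : HeytingField c ℓ₁ ℓ₂) (char0 : OverField.CharZero K)
                    (B : ℕ) (ζ : HeytingField.Carrier K)
                    (prim : OverField.IsPrimitiveRoot K (suc B) ζ) where

  open HeytingField K using (_#_; heytingCommutativeRing)
  open HeytingCommutativeRing heytingCommutativeRing using (commutativeRing)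
  open CommutativeRing commutativeRing hiding (zero)
  open OverField K using (1/[_]; _+ₚ_; sumₚ; _t^_)
  open OverField.IsPrimitiveRoot prim
  open SymmetricSums commutativeRing
  open RationalElements K char0
  open Algebra.Properties.Semiring.Exp semiring
    using (_^_; ^-congˡ; ^-congʳ; ^-homo-*; ^-assocʳ)
  open Algebra.Properties.CommutativeSemiring.Exp
    (CommutativeRing.commutativeSemiring commutativeRing) using (^-distrib-*)
  open Algebra.Properties.Semiring.Sum semiring
  open Algebra.Properties.Semiring.Mult semiring using () renaming (_×_ to _·_)
  open Algebra.Properties.Ring (CommutativeRing.ring commutativeRing) using (+-cancelʳ)
  open Algebra.Solver.Ring.NaturalCoefficients.Default commutativeSemiring
    using (solve; _:=_; _:+_; _:*_; con)
  open Relation.Binary.Reasoning.Setoid setoid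

  n : ℕ
  n = suc B

  -- Index i stands for m = i + 1, so that 0 < m < n becomes i < B.

  x : ℕ → Carrier
  x i = ζ ^ suc i

  open Polynomial Rational rational-resp rational-0 rational-1 rational-+ rational-* x

  1^ : ∀ m → 1# ^ m ≈ 1#
  1^ zero    = refl
  1^ (suc m) = trans (*-identityˡ _) (1^ m)

  geometric : Carrier → ℕ → Carrier
  geometric w b = sum {b} λ a → w ^ toℕ a

  geometric-cong : ∀ {w w′} b → w ≈ w′ → geometric w b ≈ geometric w′ b
  geometric-cong b w≈w′ = sum-cong-≋ {b} λ a → ^-congˡ (toℕ a) w≈w′

  geometric-telescope : ∀ w b → (1# - w) * geometric w b + w ^ b ≈ 1#
  geometric-telescope w zero    = trans (+-congʳ (zeroʳ _)) (+-identityˡ _)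
  geometric-telescope w (suc b) = begin
    (1# - w) * (1# + sum {b} λ a → w * w ^ toℕ a) + w * w ^ b
      ≈⟨ +-congʳ (*-congˡ (+-congˡ (*-distribˡ-sum {b} w λ a → w ^ toℕ a))) ⟨
    (1# - w) * (1# + w * geometric w b) + w * w ^ b
      ≈⟨ solve 4 (λ u w s p → u :* (con 1 :+ w :* s) :+ w :* p := u :+ w :* (u :* s :+ p))
           refl (1# - w) w (geometric w b) (w ^ b) ⟩
    1# - w + w * ((1# - w) * geometric w b + w ^ b)
      ≈⟨ +-congˡ (trans (*-congˡ (geometric-telescope w b)) (*-identityʳ w)) ⟩
    1# - w + w
      ≈⟨ trans (+-assoc _ _ _) (trans (+-congˡ (-‿inverseˡ w)) (+-identityʳ 1#)) ⟩
    1#  ∎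

  geometric-one : ∀ {w} b → w ≈ 1# → geometric w b ≈ ⟦ b ⟧
  geometric-one b w≈1 = trans
    (sum-cong-≋ {b} λ a → trans (^-congˡ (toℕ a) w≈1) (1^ (toℕ a))) (sum-replicate b)

  ζ^*n≈1 : ∀ m → (ζ ^ m) ^ n ≈ 1#
  ζ^*n≈1 m = begin
    (ζ ^ m) ^ n    ≈⟨ ^-assocʳ ζ m n ⟩
    ζ ^ (m ℕ.* n)  ≈⟨ ^-congʳ ζ (ℕ.*-comm m n) ⟩
    ζ ^ (n ℕ.* m)  ≈⟨ ^-assocʳ ζ n m ⟨
    (ζ ^ n) ^ m    ≈⟨ ^-congˡ m ζⁿ≈1 ⟩
    1# ^ m         ≈⟨ 1^ m ⟩
    1#             ∎

  geometric-ζ^ : ∀ {m} → 0 < m → m < n → geometric (ζ ^ m) n ≈ 0#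
  geometric-ζ^ {m} 0<m m<n = begin
    S                            ≈⟨ *-identityˡ S ⟨
    1# * S                       ≈⟨ *-congʳ (1/-inverse 1#w) ⟨
    1/[ 1#w ] * (1# - w) * S     ≈⟨ *-assoc _ _ _ ⟩
    1/[ 1#w ] * ((1# - w) * S)   ≈⟨ *-congˡ (+-cancelʳ 1# _ _ (begin
      (1# - w) * S + 1#            ≈⟨ +-congˡ (ζ^*n≈1 m) ⟨
      (1# - w) * S + w ^ n         ≈⟨ geometric-telescope w n ⟩
      1#                           ≈⟨ +-identityˡ 1# ⟨
      0# + 1#                      ∎)) ⟩
    1/[ 1#w ] * 0#               ≈⟨ zeroʳ _ ⟩
    0#                           ∎
    where
    w S : Carrier
    w = ζ ^ m
    S = geometric w n

    1#w : 1# # w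
    1#w = 1#ζᵐ 0<m m<n

  -- Adding the missing index m = 0 completes the sum to one over all n-th roots of unity, which is
  -- n or 0 according as n divides `j` or not. The value is therefore n - 1 or -1.
  power-sums : ∀ j → Rational (sum {B} λ i → x (toℕ i) ^ j)
  power-sums j = rational-resp (sym total) (rational-+ (geometric-rational (j % n) ≡.refl) (rational-neg rational-1))
    where
    w : Carrier
    w = ζ ^ j

    w≈ : w ≈ ζ ^ (j % n)
    w≈ = begin
      ζ ^ j                                  ≈⟨ ^-congʳ ζ (m≡m%n+[m/n]*n j n) ⟩
      ζ ^ (j % n ℕ.+ j / n ℕ.* n)            ≈⟨ ^-homo-* ζ (j % n) (j / n ℕ.* n) ⟩
      ζ ^ (j % n) * ζ ^ (j / n ℕ.* n)        ≈⟨ *-congˡ (trans (sym (^-assocʳ ζ (j / n) n)) (ζ^*n≈1 (j / n))) ⟩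
      ζ ^ (j % n) * 1#                       ≈⟨ *-identityʳ _ ⟩
      ζ ^ (j % n)                            ∎

    total : (sum {B} λ i → x (toℕ i) ^ j) ≈ geometric w n - 1#
    total = begin
      (sum {B} λ i → (ζ ^ suc (toℕ i)) ^ j)
        ≈⟨ sum-cong-≋ {B} (λ i → trans (^-assocʳ ζ (suc (toℕ i)) j)
             (trans (^-congʳ ζ (ℕ.*-comm (suc (toℕ i)) j)) (sym (^-assocʳ ζ j (suc (toℕ i)))))) ⟩
      (sum {B} λ i → w ^ suc (toℕ i))
        ≈⟨ +-identityˡ _ ⟨
      0# + (sum {B} λ i → w ^ suc (toℕ i))
        ≈⟨ +-congʳ (-‿inverseˡ 1#) ⟨
      - 1# + 1# + (sum {B} λ i → w ^ suc (toℕ i))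
        ≈⟨ trans (+-assoc _ _ _) (+-comm _ _) ⟩
      geometric w n - 1#  ∎

    geometric-rational : ∀ m → m ≡ j % n → Rational (geometric w n)
    geometric-rational zero    eq = rational-resp
      (sym (geometric-one n (trans w≈ (^-congʳ ζ (≡.sym eq))))) (rational-⟦⟧ n)
    geometric-rational (suc m) eq = rational-resp
      (sym (trans (geometric-cong n (trans w≈ (^-congʳ ζ (≡.sym eq))))
                  (geometric-ζ^ (s≤s z≤n) (≡.subst (_< n) (≡.sym eq) (m%n<n j n)))))
      rational-0

  -- Orthogonality of the characters of ℤ/n, with x j ^ B = x j ⁻¹.

  δ : ℕ → ℕ → Carrier
  δ i j = n ⁻¹ * sum {n} λ a → x i ^ toℕ a * (x j ^ B) ^ toℕ a

  δ≈geometric : ∀ {i j w} → x i * x j ^ B ≈ w → δ i j ≈ n ⁻¹ * geometric w n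
  δ≈geometric {i} {j} e = *-congˡ (sum-cong-≋ {n} λ a →
    trans (sym (^-distrib-* (x i) (x j ^ B) (toℕ a))) (^-congˡ (toℕ a) e))

  δ-refl : ∀ i → δ i i ≈ 1#
  δ-refl i = begin
    δ i i                  ≈⟨ δ≈geometric {i} {i} (ζ^*n≈1 (suc i)) ⟩
    n ⁻¹ * geometric 1# n  ≈⟨ *-congˡ (geometric-one n refl) ⟩
    n ⁻¹ * ⟦ n ⟧           ≈⟨ *-comm _ _ ⟩
    ⟦ n ⟧ * n ⁻¹           ≈⟨ ⁻¹-inverse n ⟩
    1#                     ∎

  δ-ζ^ : ∀ {i j m} → 0 < m → m < n → x i * x j ^ B ≈ ζ ^ m → δ i j ≈ 0#
  δ-ζ^ {i} {j} 0<m m<n e = trans (δ≈geometric {i} {j} e) (trans (*-congˡ (geometric-ζ^ 0<m m<n)) (zeroʳ _))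

  quotient : ∀ i m → x (m ℕ.+ i) * x i ^ B ≈ ζ ^ m
  quotient i m = begin
    ζ ^ suc (m ℕ.+ i) * x i ^ B     ≈⟨ *-congʳ (^-congʳ ζ (≡.sym (ℕ.+-suc m i))) ⟩
    ζ ^ (m ℕ.+ suc i) * x i ^ B     ≈⟨ *-congʳ (^-homo-* ζ m (suc i)) ⟩
    ζ ^ m * x i * x i ^ B           ≈⟨ *-assoc _ _ _ ⟩
    ζ ^ m * (x i * x i ^ B)         ≈⟨ *-congˡ (ζ^*n≈1 (suc i)) ⟩
    ζ ^ m * 1#                      ≈⟨ *-identityʳ _ ⟩
    ζ ^ m                           ∎

  δ-> : ∀ {i j} → i < B → j < i → δ i j ≈ 0#
  δ-> {i} {j} i<B j<i = δ-ζ^ {i} {j} (ℕ.m<n⇒0<n∸m j<i) (ℕ.≤-<-trans (ℕ.m∸n≤m i j) (ℕ.m<n⇒m<1+n i<B))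
    (trans (*-congʳ (reflexive (≡.cong x (≡.sym (ℕ.m∸n+n≡m (ℕ.<⇒≤ j<i)))))) (quotient j (i ℕ.∸ j)))

  -- The quotient of `x i` by `x j` is ζ to the negative exponent i - j. It is rewritten with the
  -- exponent `n ℕ.∸ d`, which lies strictly between 0 and n.
  δ-< : ∀ {i j} → j < B → i < j → δ i j ≈ 0#
  δ-< {i} {j} j<B i<j = δ-ζ^ {i} {j} (ℕ.m<n⇒0<n∸m d<n) (ℕ.s≤s (ℕ.≤-trans
      (ℕ.∸-monoʳ-≤ n (ℕ.m<n⇒0<n∸m i<j)) ℕ.≤-refl)) (begin
    x i * x j ^ B
      ≈⟨ *-identityʳ _ ⟨
    x i * x j ^ B * 1#
      ≈⟨ *-congˡ (trans (^-congʳ ζ (ℕ.m∸n+n≡m (ℕ.<⇒≤ d<n))) ζⁿ≈1) ⟨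
    x i * x j ^ B * ζ ^ (n ℕ.∸ d ℕ.+ d)
      ≈⟨ *-congˡ (^-homo-* ζ (n ℕ.∸ d) d) ⟩
    x i * x j ^ B * (ζ ^ (n ℕ.∸ d) * ζ ^ d)
      ≈⟨ solve 4 (λ a b c d → a :* b :* (c :* d) := c :* (d :* a :* b)) refl _ _ _ _ ⟩
    ζ ^ (n ℕ.∸ d) * (ζ ^ d * x i * x j ^ B)
      ≈⟨ *-congˡ (*-congʳ (trans (sym (^-homo-* ζ d (suc i)))
           (^-congʳ ζ (≡.trans (ℕ.+-suc d i) (≡.cong suc (ℕ.m∸n+n≡m (ℕ.<⇒≤ i<j))))))) ⟩
    ζ ^ (n ℕ.∸ d) * (x j * x j ^ B)
      ≈⟨ trans (*-congˡ (ζ^*n≈1 (suc j))) (*-identityʳ _) ⟩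
    ζ ^ (n ℕ.∸ d)  ∎)
    where
    d : ℕ
    d = j ℕ.∸ i

    d<n : d < n
    d<n = ℕ.≤-<-trans (ℕ.m∸n≤m j i) (ℕ.m<n⇒m<1+n j<B)

  δ-≢ : ∀ {i j} → i < B → j < B → i ≢ j → δ i j ≈ 0#
  δ-≢ {i} {j} i<B j<B i≢j with ℕ.<-cmp i j
  ... | tri< i<j _ _ = δ-< j<B i<j
  ... | tri≈ _ i≡j _ = ⊥-elim (i≢j i≡j)
  ... | tri> _ _ j<i = δ-> i<B j<i

  δ-polynomial : ∀ s → IsPolynomial (2 ℕ.+ s) (λ v → δ (Vec.head v) (Vec.head (Vec.tail v)))
  δ-polynomial s = constant _ (rational-⁻¹ n) ⊗ sum-poly {n = n} λ a →
    monomial (suc s) (toℕ a) ⊗ power (toℕ a) (power B (resp (λ _ → *-identityʳ _) (weaken (monomial s 1))))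

  -- n = ∑_{b<n} ((1 - w) (1 + w + ⋯ + w^(b-1)) + w^b), where ∑_{b<n} w^b = 0 if w = x i.

  y : ℕ → Carrier
  y i = n ⁻¹ * sum {n} λ b → geometric (x i) (toℕ b)

  y-inverse : ∀ {i} → i < B → (1# - x i) * y i ≈ 1#
  y-inverse {i} i<B = begin
    (1# - x i) * (n ⁻¹ * Σ)      ≈⟨ a*[b*c]≈b*[a*c] _ _ _ ⟩
    n ⁻¹ * ((1# - x i) * Σ)      ≈⟨ *-congˡ (begin
      (1# - x i) * Σ               ≈⟨ +-identityʳ _ ⟨
      (1# - x i) * Σ + 0#          ≈⟨ +-congˡ (geometric-ζ^ (s≤s z≤n) (s≤s i<B)) ⟨
      (1# - x i) * Σ + geometric (x i) n
        ≈⟨ +-congʳ (*-distribˡ-sum {n} (1# - x i) λ b → geometric (x i) (toℕ b)) ⟩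
      (sum {n} λ b → (1# - x i) * geometric (x i) (toℕ b)) + geometric (x i) n
        ≈⟨ ∑-distrib-+ {n} (λ b → (1# - x i) * geometric (x i) (toℕ b)) (λ b → x i ^ toℕ b) ⟨
      (sum {n} λ b → (1# - x i) * geometric (x i) (toℕ b) + x i ^ toℕ b)
        ≈⟨ trans (sum-cong-≋ {n} λ b → geometric-telescope (x i) (toℕ b)) (sum-replicate n) ⟩
      ⟦ n ⟧                        ∎) ⟩
    n ⁻¹ * ⟦ n ⟧                 ≈⟨ trans (*-comm _ _) (⁻¹-inverse n) ⟩
    1#                           ∎
    where
    Σ : Carrier
    Σ = sum {n} λ b → geometric (x i) (toℕ b)

  -- Uniqueness of inverses makes the inverse drawn from any apartness witness equal to the
  -- polynomial expression `y i`.
  1/≈y : ∀ {i} (1#x : 1# # x i) → i < B → 1/[ 1#x ] ≈ y i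
  1/≈y {i} 1#x i<B = begin
    1/[ 1#x ]                        ≈⟨ *-identityʳ _ ⟨
    1/[ 1#x ] * 1#                   ≈⟨ *-congˡ (y-inverse i<B) ⟨
    1/[ 1#x ] * ((1# - x i) * y i)   ≈⟨ *-assoc _ _ _ ⟨
    1/[ 1#x ] * (1# - x i) * y i     ≈⟨ *-congʳ (1/-inverse 1#x) ⟩
    1# * y i                         ≈⟨ *-identityˡ _ ⟩
    y i                              ∎

  -- The factors `f` and the coefficients of `z̄ᵗ`

  f : ℕ → ℕ → Carrier
  f k i = x i ^ (k ℕ.∸ 1) * y i ^ k

  f-polynomial : ∀ s k → IsPolynomial (suc s) (λ v → f k (Vec.head v))
  f-polynomial s k = power (k ℕ.∸ 1) x-polynomial ⊗ power k
    (constant _ (rational-⁻¹ n) ⊗ sum-poly {n = n} λ b → sum-poly {n = toℕ b} λ a → monomial s (toℕ a))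
    where
    x-polynomial : IsPolynomial (suc s) (x ∘ Vec.head)
    x-polynomial = resp (λ _ → *-identityʳ _) (monomial s 1)

  -- All three terms share the factor x^(a+b-2) y^(a+b-1), and what is left is 1 + xy = y, that is 1
  -- + x/(1-x) = 1/(1-x). Positivity makes the truncated exponents add up.
  f-merge : ∀ {a b i} → 1 ≤ a → 1 ≤ b → i < B → f (a ℕ.+ b) i + f (a ℕ.∸ 1 ℕ.+ b) i ≈ f a i * f b i
  f-merge {suc a} {suc b} {i} _ _ i<B rewrite ℕ.+-suc a b = begin
    x i ^ suc (a ℕ.+ b) * y i ^ (2 ℕ.+ (a ℕ.+ b)) + x i ^ (a ℕ.+ b) * y i ^ suc (a ℕ.+ b)
      ≈⟨ +-cong (*-cong (*-congˡ X) (*-congˡ (*-congˡ Y))) (*-cong X (*-congˡ Y)) ⟩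
    x i * (x i ^ a * x i ^ b) * (y i * (y i * (y i ^ a * y i ^ b))) +
    x i ^ a * x i ^ b * (y i * (y i ^ a * y i ^ b))
      ≈⟨ solve 6 (λ x y xa xb ya yb →
           x :* (xa :* xb) :* (y :* (y :* (ya :* yb))) :+ xa :* xb :* (y :* (ya :* yb)) :=
           xa :* (y :* ya) :* (xb :* ((con 1 :+ x :* y) :* yb)))
           refl (x i) (y i) (x i ^ a) (x i ^ b) (y i ^ a) (y i ^ b) ⟩
    x i ^ a * (y i * y i ^ a) * (x i ^ b * ((1# + x i * y i) * y i ^ b))
      ≈⟨ *-congˡ (*-congˡ (*-congʳ 1+xy≈y)) ⟩
    x i ^ a * (y i * y i ^ a) * (x i ^ b * (y i * y i ^ b))  ∎
    where
    X : x i ^ (a ℕ.+ b) ≈ x i ^ a * x i ^ b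
    X = ^-homo-* (x i) a b

    Y : y i ^ (a ℕ.+ b) ≈ y i ^ a * y i ^ b
    Y = ^-homo-* (y i) a b

    1+xy≈y : 1# + x i * y i ≈ y i
    1+xy≈y = begin
      1# + x i * y i                    ≈⟨ +-congʳ (y-inverse i<B) ⟨
      (1# - x i) * y i + x i * y i      ≈⟨ distribʳ (y i) (1# - x i) (x i) ⟨
      (1# - x i + x i) * y i
        ≈⟨ *-congʳ (trans (+-assoc _ _ _) (trans (+-congˡ (-‿inverseˡ (x i))) (+-identityʳ 1#))) ⟩
      1# * y i                          ≈⟨ *-identityˡ _ ⟩
      y i                               ∎

  -- With m = i + 1, the bound m < N becomes i < `ℕ.pred N`.
  z̄-below≈strictOf : ∀ {N} (N≤n : N ≤ n) ks →
                     OverField.z̄-below K n ζ 1#ζᵐ N N≤n ks ≈ strictOf f (ℕ.pred N) ks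
  z̄-below≈strictOf         N≤n []       = refl
  z̄-below≈strictOf {zero}  N≤n (k ∷ ks) = refl
  z̄-below≈strictOf {suc N} N≤n (k ∷ ks) = sum-cong-≋ {N} λ i → *-cong
    (*-cong
      (trans (^-congʳ ζ (ℕ.*-comm (k ℕ.∸ 1) (suc (toℕ i)))) (sym (^-assocʳ ζ (suc (toℕ i)) (k ℕ.∸ 1))))
      (^-congˡ k (1/≈y _ (ℕ.<-≤-trans (toℕ<n i) (ℕ.s≤s⁻¹ N≤n)))))
    (z̄-below≈strictOf _ ks)

  coeff-+ₚ : ∀ p p′ i → coeff 0# (p +ₚ p′) i ≈ coeff 0# p i + coeff 0# p′ i
  coeff-+ₚ []      p′       i       = sym (+-identityˡ _)
  coeff-+ₚ (a ∷ p) []       i       = sym (+-identityʳ _)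
  coeff-+ₚ (a ∷ p) (b ∷ p′) zero    = refl
  coeff-+ₚ (a ∷ p) (b ∷ p′) (suc i) = coeff-+ₚ p p′ i

  coeff-sumₚ : ∀ {a} {A : Set a} (g : A → List Carrier) xs i →
               coeff 0# (sumₚ (List.map g xs)) i ≈ sumₗ xs λ a → coeff 0# (g a) i
  coeff-sumₚ g []       i = refl
  coeff-sumₚ g (a ∷ xs) i = trans (coeff-+ₚ (g a) _ i) (+-congˡ (coeff-sumₚ g xs i))

  -- The factor `coeff 0# (1# t^ j) i` is the Kronecker symbol of `i` and `j`. Split off, it becomes
  -- the weight that `weak` attaches to the number of descents.
  coeff-t^ : ∀ a j i → coeff 0# (a t^ j) i ≈ coeff 0# (1# t^ j) i * a
  coeff-t^ a zero    zero    = sym (*-identityˡ a)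
  coeff-t^ a zero    (suc i) = sym (zeroˡ a)
  coeff-t^ a (suc j) zero    = sym (zeroˡ a)
  coeff-t^ a (suc j) (suc i) = coeff-t^ a j i

  coeff-t^-rational : ∀ j i → Rational (coeff 0# (1# t^ j) i)
  coeff-t^-rational zero    zero    = rational-1
  coeff-t^-rational zero    (suc i) = rational-0
  coeff-t^-rational (suc j) zero    = rational-0
  coeff-t^-rational (suc j) (suc i) = coeff-t^-rational j i

  -- The exponent of t counts merged boxes, hence equalities between neighbouring indices; a word of
  -- `suc l` letters with `s` descents has `l ∸ s` of them.
  coeff-z̄ᵗ : ∀ {l} (𝐤 : Vec ℕ (suc l)) → VecAll.All (1 ≤_) 𝐤 → ∀ i →
    coeff 0# (OverField.z̄ᵗ K n ζ 1#ζᵐ 𝐤) i ≈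
    sum {B} λ j → weak (toℕ j) (λ s → coeff 0# (1# t^ (l ℕ.∸ s)) i) l (weightOf f 𝐤 ∘ (toℕ j ∷_))
  coeff-z̄ᵗ {l} (k ∷ ks) (1≤k ∷ 1≤ks) i = begin
    coeff 0# (OverField.z̄ᵗ K n ζ 1#ζᵐ (k ∷ ks)) i
      ≈⟨ coeff-sumₚ _ (vectors boxes l) i ⟩
    (sumₗ (vectors boxes l) λ □s →
       coeff 0# (OverField.z̄ K n ζ 1#ζᵐ (fill k □s ks) t^ (suc l ℕ.∸ length (fill k □s ks))) i)
      ≈⟨ sum-cong-≋ {length (vectors boxes l)} (λ j → trans
           (coeff-t^ _ (suc l ℕ.∸ length (fill k (List.lookup (vectors boxes l) j) ks)) i)
           (*-congˡ (z̄-below≈strictOf ℕ.≤-refl (fill k (List.lookup (vectors boxes l) j) ks)))) ⟩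
    (sumₗ (vectors boxes l) λ □s → w (length (fill k □s ks)) * strictOf f B (fill k □s ks))
      ≈⟨ fillings≈weak f-merge ℕ.≤-refl w 1≤k 1≤ks ⟩
    (sum {B} λ j → f k (toℕ j) * weak (toℕ j) (w ∘ suc) l (weightOf f ks))
      ≈⟨ sum-cong-≋ {B} (λ j → Linear.*-homo (weak-linear (toℕ j) (w ∘ suc) l) (f k (toℕ j)) (weightOf f ks)) ⟨
    (sum {B} λ j → weak (toℕ j) (w ∘ suc) l (weightOf f (k ∷ ks) ∘ (toℕ j ∷_)))  ∎
    where
    w : ℕ → Carrier
    w s = coeff 0# (1# t^ (suc l ℕ.∸ s)) i

  -- The index sets as symmetric indicator functions

  indicator : ∀ {a} {A : Set a} → Dec A → Carrier
  indicator A? = if does A? then 1# else 0#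

  indicator-⇔ : ∀ {a b} {A : Set a} {B : Set b} (A? : Dec A) (B? : Dec B) →
                (A → B) → (B → A) → indicator A? ≈ indicator B?
  indicator-⇔ (yes a) (yes b) f g = refl
  indicator-⇔ (no ¬a) (no ¬b) f g = refl
  indicator-⇔ (yes a) (no ¬b) f g = ⊥-elim (¬b (f a))
  indicator-⇔ (no ¬a) (yes b) f g = ⊥-elim (¬a (g b))

  indicator-rational : ∀ {a} {A : Set a} (A? : Dec A) → Rational (indicator A?)
  indicator-rational (yes _) = rational-1
  indicator-rational (no _)  = rational-0

  sumₗ-filter : ∀ {a p} {A : Set a} {P : A → Set p} (P? : Decidable P) (xs : List A) {g g′ : A → Carrier} →
                (∀ a → P a → g a ≈ g′ a) →
                sumₗ (List.filter P? xs) g ≈ sumₗ xs λ a → indicator (P? a) * g′ a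
  sumₗ-filter P? []       g≈g′ = refl
  sumₗ-filter P? (a ∷ xs) g≈g′ with P? a
  ... | yes pa = +-cong (trans (g≈g′ a pa) (sym (*-identityˡ _))) (sumₗ-filter P? xs g≈g′)
  ... | no  _  = trans (sumₗ-filter P? xs g≈g′) (sym (trans (+-congʳ (zeroˡ _)) (+-identityˡ _)))

  module _ {r} (k : ℕ) (h : Vec ℕ r) where

    -- `InI` accepts `Vec.fromList ks` at whatever length `ks` has, so the depth is tested
    -- separately; this test gives the support condition.
    χ? : ∀ l (ks : List ℕ) → Dec (length ks ≡ l × InI k h (Vec.fromList ks))
    χ? l ks = (length ks ℕ.≟ l) ×-dec InI? k h (Vec.fromList ks)

    χ : ℕ → List ℕ → Carrier
    χ l ks = indicator (χ? l ks)

    χ-toList : ∀ {l} (𝐤 : Vec ℕ l) → indicator (InI? k h 𝐤) ≈ χ l (toList 𝐤)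
    χ-toList {l} 𝐤 = indicator-⇔ (InI? k h 𝐤) (χ? l (toList 𝐤))
      (λ 𝐤∈I → ≡.subst Labelling (≡.sym (fromList∘toList 𝐤)) (≡.refl , 𝐤∈I))
      (λ 𝐤∈I → proj₂ (≡.subst Labelling (fromList∘toList 𝐤) 𝐤∈I))
      where
      Labelling : ∃ (Vec ℕ) → Set
      Labelling (m , v) = m ≡ l × InI k h v

      -- The two vectors have different types until their lengths are identified, so the equality is
      -- stated for pairs of a length and a vector.
      fromList∘toList : ∀ {l} (v : Vec ℕ l) → (length (toList v) , Vec.fromList (toList v)) ≡ (l , v)
      fromList∘toList []      = ≡.refl
      fromList∘toList (a ∷ v) = ≡.cong (λ (m , u) → suc m , a ∷ u) (fromList∘toList v)

    χ-supported : ∀ l → SupportedOn l (χ l)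
    χ-supported l ks |ks|≢l = indicator-⇔ (χ? l ks) (no λ ()) (⊥-elim ∘ |ks|≢l ∘ proj₁) ⊥-elim

    -- Positivity, weight, depth and heights depend only on the multiset of entries.
    χ-symmetric : ∀ l → Symmetric (χ l)
    χ-symmetric l p = indicator-⇔ (χ? l _) (χ? l _) (transport p) (transport (↭.↭-sym p))
      where
      InI-↭ : ∀ {M M′} → M ↭ M′ → InI k h (Vec.fromList M) → InI k h (Vec.fromList M′)
      InI-↭ p (pos , wt , ht) =
        VecAll-fromList (↭ₚ.All-resp-↭ p (fromList-VecAll pos)) ,
        ≡.trans (≡.sym (weight-↭ p)) wt ,
        λ i → ≡.trans (≡.sym (height-↭ (suc (toℕ i)) p)) (ht i)
        where
        fromList-VecAll : ∀ {M} → VecAll.All (1 ≤_) (Vec.fromList M) → All (1 ≤_) M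
        fromList-VecAll {[]}    []       = []
        fromList-VecAll {_ ∷ _} (q ∷ qs) = q ∷ fromList-VecAll qs

        VecAll-fromList : ∀ {M} → All (1 ≤_) M → VecAll.All (1 ≤_) (Vec.fromList M)
        VecAll-fromList []       = []
        VecAll-fromList (q ∷ qs) = q ∷ VecAll-fromList qs

        weight-↭ : ∀ {M M′} → M ↭ M′ → weight (Vec.fromList M) ≡ weight (Vec.fromList M′)
        weight-↭ ↭.refl         = ≡.refl
        weight-↭ (↭.prep a p)   = ≡.cong (a ℕ.+_) (weight-↭ p)
        weight-↭ (↭.swap {xs = M} a b p) = ≡.trans (≡.sym (ℕ.+-assoc a b _))
          (≡.trans (≡.cong₂ ℕ._+_ (ℕ.+-comm a b) (weight-↭ p)) (ℕ.+-assoc b a _))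
        weight-↭ (↭.trans p q)  = ≡.trans (weight-↭ p) (weight-↭ q)

        height-↭ : ∀ i {M M′} → M ↭ M′ → height i (Vec.fromList M) ≡ height i (Vec.fromList M′)
        height-↭ i ↭.refl         = ≡.refl
        height-↭ i (↭.prep a p) with does (suc i ℕ.≤? a)
        ... | true  = ≡.cong suc (height-↭ i p)
        ... | false = height-↭ i p
        height-↭ i (↭.swap a b p) with does (suc i ℕ.≤? a) | does (suc i ℕ.≤? b)
        ... | true  | true  = ≡.cong (2 ℕ.+_) (height-↭ i p)
        ... | true  | false = ≡.cong suc (height-↭ i p)
        ... | false | true  = ≡.cong suc (height-↭ i p)
        ... | false | false = height-↭ i p
        height-↭ i (↭.trans p q)  = ≡.trans (height-↭ i p) (height-↭ i q)

      transport : ∀ {M M′} → M ↭ M′ → length M ≡ l × InI k h (Vec.fromList M) →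
                  length M′ ≡ l × InI k h (Vec.fromList M′)
      transport p (|M|≡l , M∈I) = ≡.trans (≡.sym (↭ₚ.↭-length p)) |M|≡l , InI-↭ p M∈I

    G-rational : ∀ l i → Rational (coeff 0# (OverField.G K n ζ 1#ζᵐ k l h) i)
    -- Depth zero stands apart because `weak` needs a first letter; here each summand is the
    -- constant polynomial 1.
    G-rational zero i = rational-resp (sym (coeff-sumₚ _ (I k zero h) i))
      (sumₗ-rational (I k zero h))
      where
      sumₗ-rational : ∀ (vs : List (Vec ℕ 0)) →
        Rational (sumₗ vs λ v → coeff 0# (OverField.z̄ᵗ K n ζ 1#ζᵐ v) i)
      sumₗ-rational []        = rational-0
      sumₗ-rational ([] ∷ vs) = rational-+ (coeff-t^-rational 0 i) (sumₗ-rational vs)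
    G-rational (suc l) i = rational-resp (sym (begin
      coeff 0# (OverField.G K n ζ 1#ζᵐ k (suc l) h) i
        ≈⟨ coeff-sumₚ _ (I k (suc l) h) i ⟩
      (sumₗ (I k (suc l) h) λ 𝐤 → coeff 0# (OverField.z̄ᵗ K n ζ 1#ζᵐ 𝐤) i)
        -- Membership supplies the positivity that `coeff-z̄ᵗ` requires; words outside the index set
        -- carry the coefficient 0.
        ≈⟨ sumₗ-filter (InI? k h) words (λ 𝐤 𝐤∈I → coeff-z̄ᵗ 𝐤 (proj₁ 𝐤∈I) i) ⟩
      (sumₗ words λ 𝐤 → indicator (InI? k h 𝐤) * 𝓦 (weightOf f 𝐤))
        ≈⟨ sum-cong-≋ {length words} (λ j → *-congʳ (χ-toList (List.lookup words j))) ⟩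
      (sumₗ words λ 𝐤 → χ (suc l) (toList 𝐤) * 𝓦 (weightOf f 𝐤))
        -- The sum over multi-indices moves inside the functional, because symmetry holds for the
        -- combined function of the word and in general not for a single `weightOf f 𝐤`.
        ≈⟨ Linear.combination 𝓦-linear {length words}
             (λ j → χ (suc l) (toList (List.lookup words j))) (λ j → weightOf f (List.lookup words j)) ⟨
      𝓦 (λ M → sumₗ words λ 𝐤 → χ (suc l) (toList 𝐤) * weightOf f 𝐤 M)
        ≈⟨ Linear.cong 𝓦-linear (labelled≈sum (suc l) (χ-supported (suc l))) ⟩
      𝓦 (labelled (χ (suc l)))  ∎))
      (weakly-decreasing-P B power-sums δ δ-refl δ-≢ rational-neg δ-polynomial rational-÷ f alphabet f-polynomial
        l (λ s → coeff-t^-rational (l ℕ.∸ s) i) (λ ks → indicator-rational (χ? (suc l) ks))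
        (χ-symmetric (suc l)) (χ-supported (suc l)))
      where
      alphabet : List ℕ
      alphabet = List.map suc (List.upTo k)

      open Labelled f alphabet

      words : List (Vec ℕ (suc l))
      words = vectors alphabet (suc l)

      w : ℕ → Carrier
      w s = coeff 0# (1# t^ (l ℕ.∸ s)) i

      𝓦 : Functional
      𝓦 Ψ = sum {B} λ j → weak (toℕ j) w l (Ψ ∘ (toℕ j ∷_))

      𝓦-linear : Linear 𝓦
      𝓦-linear = sum-linear {B} λ j → translation-linear (toℕ j ∷_) (weak-linear (toℕ j) w l)

corollary1p2 : ∀ {c ℓ₁ ℓ₂} (K : HeytingField c ℓ₁ ℓ₂) →
    let open HeytingField K using (Carrier)
        open OverField K
    in
    (char0 : CharZero) (n r : ℕ) .{{_ : NonZero n}} .{{_ : NonZero r}}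
    (ζ : Carrier) (prim : IsPrimitiveRoot n ζ) (k l : ℕ) (h : Vec ℕ r) →
    G n ζ (IsPrimitiveRoot.1#ζᵐ prim) k l h ∈ℚ[t] char0
corollary1p2 K char0 (suc B) r ζ prim k l h =
  RationalElements.rational-coefficients K char0
    (OverField.G K (suc B) ζ (OverField.IsPrimitiveRoot.1#ζᵐ prim) k l h)
    (RootsOfUnity.G-rational K char0 B ζ prim k h l)
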